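{- For every instance of the linear tape sequencing problem (LTS) with $n$ files and $m$ requested files, the optimal value $R^*$ of the LTS is given by $\mathfrak R(1,n,m)$, where $\mathfrak R$ (together with $\mathfrak F$) is defined by the mutual recursions in the context, and $\mathfrak R(1,n,m)$ can be computed in time $\mathcal O(n^4)$.
   Context: LTS (linear tape sequencing problem). A tape is a set of files $\mathscr F=\{1,\dots,n\}$ stored contiguously, in index order from left to right, on a line. File $i$ has size $s_i$ (a positive integer number of bits), left position $\ell_i$ and right position $r_i=\ell_i+s_i$, with $\ell_1=0$, $\ell_{i+1}=r_i$, and tape length $L=r_n=\sum_i s_i$. Parameters $w_i\in\{0,1\}$ indicate whether file $i$ is requested ($w_i=1$) or not; it is assumed that $w_1=1$, and $m=\sum_i w_i$. The tape head starts at position $L$. A file is read by moving the head from $\ell_i$ to $r_i$; the head moves at unit speed. A solution is a permutation $\pi=(\pi_1,\dots,\pi_n)$ of $\mathscr F$ (reading order). The response time of the $t$-th file is $$R_t(\pi)=\sum_{t'=1}^{t}\bigl(s_{\pi_{t'-1}}+d_{\pi_{t'-1},\pi_{t'}}\bigr),\qquad d_{i,j}=|\ell_j-r_i|,$$ with the conventions $s_{\pi_0}=0$ and $r_{\pi_0}=L$. The objective value of $\pi$ is $\sum_{t=1}^n w_{\pi_t}R_t(\pi)$, and the LTS asks for $R^*=\min_\pi \sum_{t=1}^n w_{\pi_t}R_t(\pi)$. Recursions. For files $i\le j$ and a number $k$ of pending requests, write $k'_{a,b}=k-\sum_{c=a}^{b}w_c$ (so $k'_{a,b}$ depends on the current argument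 $k$, and equals $k$ if $a>b$). Define $$\mathfrak R(i,j,k)=\begin{cases}\min\Bigl\{\min\limits_{i<j'\le j}\bigl\{\mathfrak R(j',j,k)+\mathfrak R(i,j'-1,k'_{j',j})\bigr\},\ \mathfrak F(i,j,k)+k'_{i,j}\,d_{j,i}\Bigr\}, & i<j,\\[4pt] k\,s_i+2(k-w_i)s_i, & i=j,\end{cases}$$ $$\mathfrak F(i,j,k)=k\,s_j+\min_{i\le j'<j}\bigl\{\mathfrak R(j'+1,j-1,k)+\mathfrak F(i,j',k'_{j'+1,j-1})+k'_{i,j-1}\,d_{j',j}\bigr\}+k'_{i,j}\,s_j .$$ Conventions: $\mathfrak R(a,b,k)=0$ if $a>b$ (empty set of files), and when $i=j$ the minimum in the definition of $\mathfrak F$ (over an empty set) is omitted, i.e. $\mathfrak F(i,i,k)=k\,s_i+(k-w_i)s_i$. Running time counts elementary arithmetic operations at unit cost. -}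

module Defs where

open import Data.Bool using (if_then_else_)
open import Data.Fin using (Fin; zero; suc; toℕ; inject₁)
open import Data.Fin.Permutation using (Permutation′; _⟨$⟩ʳ_)
open import Data.List using (List; []; _∷_; map; applyUpTo)
open import Data.List.Extrema.Nat using (min)
open import Data.List.Properties using (map-cong-local)
open import Data.List.Relation.Unary.All.Properties using (applyUpTo⁺₁)
open import Data.Nat
  using (ℕ; zero; suc; pred; _+_; _*_; _∸_; _≤_; _<_; _≡ᵇ_; _≤ᵇ_; ∣_-_∣; z≤n; s≤s; s≤s⁻¹)
open import Data.Nat.ListAction using (sum)
open import Data.Nat.Properties
open import Algebra.Properties.CommutativeMonoid.Sum +-0-commutativeMonoid
  using (sum-syntax)
open import Data.Product using (∃; _×_; _,_; proj₁; proj₂)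
open import Function using (_∘_)
open import Relation.Binary using (tri<; tri≈; tri>)
open import Relation.Binary.PropositionalEquality using (_≡_; refl; sym; cong; cong₂)
open import Relation.Nullary using (contradiction)

-- The integers of the half-open interval a ≤ x < b, in increasing order.
range : ℕ → ℕ → List ℕ
range a b = applyUpTo (a +_) (b ∸ a)

-- The value 0 on [] renders "a minimum over the empty set is omitted".
minimum : List ℕ → ℕ
minimum []       = 0
minimum (x ∷ xs) = min x xs

-- prefixSum f t = f 0 + ⋯ + f t, with f t included.
prefixSum : ∀ {n} → (Fin n → ℕ) → Fin n → ℕ
prefixSum f zero    = f zero
prefixSum f (suc t) = f zero + prefixSum (f ∘ suc) t

extend : ∀ {n} → (Fin n → ℕ) → ℕ → ℕ
extend {zero}  f _       = 0
extend {suc n} f zero    = f zero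
extend {suc n} f (suc i) = extend (f ∘ suc) i

-- Files are numbered 0, …, last; there is at least one file, since the
-- leftmost one is requested.
record LTS : Set where
  field
    last    : ℕ

  n : ℕ
  n = suc last

  field
    size    : Fin n → ℕ
    size>0  : ∀ i → 0 < size i
    req     : Fin n → ℕ
    req≤1   : ∀ i → req i ≤ 1
    req₀    : req zero ≡ 1

  -- Sizes and requests as functions on ℕ, so that the recursions can do
  -- arithmetic on file numbers; the value beyond the last file is 0.
  s w : ℕ → ℕ
  s = extend size
  w = extend req

  m : ℕ
  m = ∑[ i < n ] req i

  ℓ r : ℕ → ℕ
  ℓ i = sum (map s (range 0 i))
  r i = ℓ i + s i

  L : ℕ
  L = r last

  d : ℕ → ℕ → ℕ
  d i j = ∣ ℓ j - r i ∣

  -- Position t of the reading order holds file π ⟨$⟩ʳ t.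
  file : Permutation′ n → Fin n → ℕ
  file π t = toℕ (π ⟨$⟩ʳ t)

  -- The t-th summand of the response time; the head starts at L, with
  -- nothing read before the first file.
  leg : Permutation′ n → Fin n → ℕ
  leg π zero    = ∣ ℓ (file π zero) - L ∣
  leg π (suc t) = s (file π (inject₁ t)) + d (file π (inject₁ t)) (file π (suc t))

  -- The time until the reading of the t-th file starts.
  response : Permutation′ n → Fin n → ℕ
  response π = prefixSum (leg π)

  cost : Permutation′ n → ℕ
  cost π = ∑[ t < n ] (w (file π t) * response π t)

  IsOptimalValue : ℕ → Set
  IsOptimalValue v = (∃ λ π → cost π ≡ v) × (∀ π → v ≤ cost π)

  -- k′ k a b = k − (w a + ⋯ + w b).  In every call reached from ℜ 0 last m, k
  -- is at least the number of requested files among i, …, j, so the truncated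
  -- subtractions here and in the recursions never truncate there.
  k′ : ℕ → ℕ → ℕ → ℕ
  k′ k a b = k ∸ sum (map w (range a (suc b)))

  -- The right-hand sides of the recursions, in terms of the two functions R and F
  -- used for the recursive calls.
  module _ (R F : ℕ → ℕ → ℕ → ℕ) where

    𝔉-rhs : ℕ → ℕ → ℕ → ℕ
    𝔉-rhs i j k =
      k * s j
      + minimum (map (λ j′ → R (suc j′) (pred j) k
                             + F i j′ (k′ k (suc j′) (pred j))
                             + k′ k i (pred j) * d j′ j)
                     (range i j))
      + k′ k i j * s j

    ℜ-rhs< : ℕ → ℕ → ℕ → ℕ
    ℜ-rhs< i j k =
      min (F i j k + k′ k i j * d j i)
          (map (λ j′ → R j′ j k + R i (pred j′) (k′ k j′ j))
               (range (suc i) (suc j)))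

    ℜ-rhs : ℕ → ℕ → ℕ → ℕ
    ℜ-rhs i j k with <-cmp i j
    ... | tri< _ _ _ = ℜ-rhs< i j k
    ... | tri≈ _ _ _ = k * s i + 2 * (k ∸ w i) * s i
    ... | tri> _ _ _ = 0

  -- The recursion is on j − i, bounded here by a depth; ℜ-rec, ℜ-base, ℜ-empty
  -- and 𝔉-rec below show that the depths chosen for ℜ and 𝔉 always suffice.
  mutual
    ℜ-depth : ℕ → ℕ → ℕ → ℕ → ℕ
    ℜ-depth zero    i j k = 0
    ℜ-depth (suc e) i j k = ℜ-rhs (ℜ-depth e) (𝔉-depth (suc e)) i j k

    𝔉-depth : ℕ → ℕ → ℕ → ℕ → ℕ
    𝔉-depth zero    i j k = 0
    𝔉-depth (suc e) i j k = 𝔉-rhs (ℜ-depth e) (𝔉-depth e) i j k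

  ℜ 𝔉 : ℕ → ℕ → ℕ → ℕ
  ℜ i j k = ℜ-depth (suc (j ∸ i)) i j k
  𝔉 i j k = 𝔉-depth (suc (j ∸ i)) i j k

  private
    right< : ∀ {i j e x} → x < j ∸ i → j ∸ i ≤ e → j ∸ suc (i + x) < e
    right< {i} {j} {e} {x} x< ≤e = begin-strict
      j ∸ suc (i + x)   ≡⟨ cong (j ∸_) (sym (+-suc i x)) ⟩
      j ∸ (i + suc x)   ≡⟨ sym (∸-+-assoc j i (suc x)) ⟩
      (j ∸ i) ∸ suc x   <⟨ ∸-monoʳ-< (s≤s (z≤n {x})) x< ⟩
      j ∸ i             ≤⟨ ≤e ⟩
      e                 ∎
      where open ≤-Reasoning

    mid< : ∀ {i j e x} → x < j ∸ i → j ∸ i ≤ e → pred j ∸ suc (i + x) < e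
    mid< {i} {j} {e} {x} x< ≤e =
      ≤-<-trans (∸-monoˡ-≤ (suc (i + x)) (pred[n]≤n {j})) (right< {i} {j} x< ≤e)

    left< : ∀ {i j e x} → x < j ∸ i → j ∸ i ≤ e → (i + x) ∸ i < e
    left< {i} {x = x} x< ≤e rewrite m+n∸m≡n i x = <-≤-trans x< ≤e

    ℜ-rhs-cong : ∀ {R F R′ F′} i j k → ℜ-rhs< R F i j k ≡ ℜ-rhs< R′ F′ i j k →
                 ℜ-rhs R F i j k ≡ ℜ-rhs R′ F′ i j k
    ℜ-rhs-cong i j k eq with <-cmp i j
    ... | tri< _ _ _ = eq
    ... | tri≈ _ _ _ = refl
    ... | tri> _ _ _ = refl

  mutual
    ℜ-stable : ∀ e e′ i j k → j ∸ i < e → j ∸ i < e′ →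
               ℜ-depth e i j k ≡ ℜ-depth e′ i j k
    ℜ-stable (suc e) (suc e′) i j k p q = ℜ-rhs-cong i j k (cong₂ min
      (cong (_+ k′ k i j * d j i) (𝔉-stable (suc e) (suc e′) i j k p q))
      (map-cong-local (applyUpTo⁺₁ (suc i +_) (j ∸ i) λ x< → cong₂ _+_
        (ℜ-stable e e′ _ _ _ (right< {i} {j} x< (s≤s⁻¹ p)) (right< {i} {j} x< (s≤s⁻¹ q)))
        (ℜ-stable e e′ _ _ _ (left< {i} {j} x< (s≤s⁻¹ p)) (left< {i} {j} x< (s≤s⁻¹ q))))))

    𝔉-stable : ∀ e e′ i j k → j ∸ i < e → j ∸ i < e′ →
               𝔉-depth e i j k ≡ 𝔉-depth e′ i j k
    𝔉-stable (suc e) (suc e′) i j k p q =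
      cong (λ xs → k * s j + minimum xs + k′ k i j * s j)
        (map-cong-local (applyUpTo⁺₁ (i +_) (j ∸ i) λ {x} x< →
          cong (_+ k′ k i (pred j) * d (i + x) j) (cong₂ _+_
            (ℜ-stable e e′ _ _ _ (mid< {i} {j} x< (s≤s⁻¹ p)) (mid< {i} {j} x< (s≤s⁻¹ q)))
            (𝔉-stable e e′ _ _ _ (left< {i} {j} x< (s≤s⁻¹ p)) (left< {i} {j} x< (s≤s⁻¹ q))))))

  ℜ-rec : ∀ {i j} k → i < j → ℜ i j k ≡ ℜ-rhs< ℜ 𝔉 i j k
  ℜ-rec {i} {j} k i<j with <-cmp i j
  ... | tri≈ i≮j _ _ = contradiction i<j i≮j
  ... | tri> i≮j _ _ = contradiction i<j i≮j
  ... | tri< _ _ _ = cong (min (𝔉 i j k + k′ k i j * d j i))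
    (map-cong-local (applyUpTo⁺₁ (suc i +_) (j ∸ i) λ x< → cong₂ _+_
      (ℜ-stable _ _ _ _ _ (right< {i} {j} x< ≤-refl) (n<1+n _))
      (ℜ-stable _ _ _ _ _ (left< {i} {j} x< ≤-refl) (n<1+n _))))

  ℜ-base : ∀ i k → ℜ i i k ≡ k * s i + 2 * (k ∸ w i) * s i
  ℜ-base i k with <-cmp i i
  ... | tri< _ i≢i _ = contradiction refl i≢i
  ... | tri≈ _ _ _   = refl
  ... | tri> _ i≢i _ = contradiction refl i≢i

  ℜ-empty : ∀ {i j} k → j < i → ℜ i j k ≡ 0
  ℜ-empty {i} {j} k j<i with <-cmp i j
  ... | tri< _ _ j≮i = contradiction j<i j≮i
  ... | tri≈ _ _ j≮i = contradiction j<i j≮i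
  ... | tri> _ _ _   = refl

  𝔉-rec : ∀ i j k → 𝔉 i j k ≡ 𝔉-rhs ℜ 𝔉 i j k
  𝔉-rec i j k =
    cong (λ xs → k * s j + minimum xs + k′ k i j * s j)
      (map-cong-local (applyUpTo⁺₁ (i +_) (j ∸ i) λ {x} x< →
        cong (_+ k′ k i (pred j) * d (i + x) j) (cong₂ _+_
          (ℜ-stable _ _ _ _ _ (mid< {i} {j} x< ≤-refl) (n<1+n _))
          (𝔉-stable _ _ _ _ _ (left< {i} {j} x< ≤-refl) (n<1+n _)))))

-- A unit-cost random access machine with structured control flow: registers
-- and finitely many arrays, both named by numerals fixed in the program text,
-- holding natural numbers.  Every operator, constant, register or array
-- access, assignment, test and loop iteration costs one unit.

infixl 6 _⊕_ _⊖_
infixl 7 _⊗_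
infix  4 _≔_
infixr 3 _⨟_

data Expr : Set where
  lit         : ℕ → Expr
  reg         : ℕ → Expr
  load        : ℕ → Expr → Expr
  _⊕_ _⊖_ _⊗_ : Expr → Expr → Expr

data Program : Set where
  skip  : Program
  _≔_   : ℕ → Expr → Program
  store : ℕ → Expr → Expr → Program
  _⨟_   : Program → Program → Program
  if≤   : Expr → Expr → Program → Program → Program
  for   : ℕ → Expr → Program → Program

record State : Set where
  constructor state
  field
    regs   : ℕ → ℕ
    arrays : ℕ → ℕ → ℕ

open State public

_[_↦_] : ∀ {A : Set} → (ℕ → A) → ℕ → A → ℕ → A
(f [ x ↦ v ]) y = if x ≡ᵇ y then v else f y

setReg : ℕ → ℕ → State → State
setReg x v σ = state (regs σ [ x ↦ v ]) (arrays σ)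

setArray : ℕ → ℕ → ℕ → State → State
setArray a x v σ = state (regs σ) (arrays σ [ a ↦ arrays σ a [ x ↦ v ] ])

eval : Expr → State → ℕ
eval (lit c) σ    = c
eval (reg x) σ    = regs σ x
eval (load a e) σ = arrays σ a (eval e σ)
eval (e ⊕ e′) σ   = eval e σ + eval e′ σ
eval (e ⊖ e′) σ   = eval e σ ∸ eval e′ σ
eval (e ⊗ e′) σ   = eval e σ * eval e′ σ

time : Expr → ℕ
time (lit _)    = 1
time (reg _)    = 1
time (load _ e) = suc (time e)
time (e ⊕ e′)   = suc (time e + time e′)
time (e ⊖ e′)   = suc (time e + time e′)
time (e ⊗ e′)   = suc (time e + time e′)

iterate : (ℕ → State → State × ℕ) → ℕ → State → State × ℕ
iterate f zero    σ = σ , 0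
iterate f (suc b) σ =
  let σ₁ , t₁ = iterate f b σ
      σ₂ , t₂ = f b σ₁
  in  σ₂ , t₁ + suc t₂

-- The final state and the running time.  The loop for x e P runs P with
-- x = 0, …, b − 1, where b is the value of e on entry.
exec : Program → State → State × ℕ
exec skip σ = σ , 1
exec (x ≔ e) σ = setReg x (eval e σ) σ , suc (time e)
exec (store a e e′) σ =
  setArray a (eval e σ) (eval e′ σ) σ , suc (time e + time e′)
exec (P ⨟ Q) σ =
  let σ₁ , t₁ = exec P σ
      σ₂ , t₂ = exec Q σ₁
  in  σ₂ , t₁ + t₂
exec (if≤ e e′ P Q) σ =
  let σ₁ , t₁ = if eval e σ ≤ᵇ eval e′ σ then exec P σ else exec Q σ
  in  σ₁ , suc (time e + time e′ + t₁)
exec (for x e P) σ =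
  let σ₁ , t₁ = iterate (λ i τ → exec P (setReg x i τ)) (eval e σ) σ
  in  σ₁ , suc (time e + t₁)

-- Input: n in register 0, the sizes in array 0, the requests in array 1; all
-- other memory cells are 0.  Output: register 0.
input : LTS → State
input I = state ((λ _ → 0) [ 0 ↦ n ]) (((λ _ _ → 0) [ 0 ↦ s ]) [ 1 ↦ w ])
  where open LTS I

output : Program → LTS → ℕ
output P I = regs (proj₁ (exec P (input I))) 0

runningTime : Program → LTS → ℕ
runningTime P I = proj₂ (exec P (input I))

{-# OPTIONS --safe --termination-depth=2 #-}
module Submission where

-- Lower bound.  Follow the head through any reading order in steps of one file and count
-- a file as read as soon as the head first crosses it from left to right; this only lowers
-- the number of pending requests.  If y is the leftmost position visited, then the unread
-- files are those left of y and a stack of skipped files, all to the right of the head.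
-- The cost so far always dominates the value of a partial derivation of the recursions:
-- skipping a file opens an 𝔉, and crossing it from the left closes this 𝔉.
-- Upper bound.  Unfolding the minima yields a list of files, and the triangle inequality
-- lets the tours of its parts be concatenated.
-- Running time.  ℜ and 𝔉 are tabulated for all i, j and k ≤ n in order of decreasing i and
-- increasing j, with prefix sums providing ℓ and the sums of w, so a cell costs O(n).

open import Defs
open import Data.Bool using (true; false; T; if_then_else_)
open import Data.Fin using (Fin; zero; suc; toℕ; fromℕ<; cast; inject₁)
open import Data.Fin.Permutation using (Permutation′; _⟨$⟩ʳ_; _⟨$⟩ˡ_; inverseʳ; cast-id; _∘ₚ_)
open import Data.Fin.Properties using (toℕ<n; toℕ-fromℕ<; toℕ-cast; cast-is-id)
open import Data.List
  using (List; []; _∷_; [_]; _++_; _∷ʳ_; map; applyUpTo; tabulate; lookup; length)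
open import Data.List.Extrema.Nat using (min; min≤⊤; min≤xs; argmin-sel; v≤min⁺)
open import Data.List.Membership.Propositional using (_∈_)
open import Data.List.Membership.Propositional.Properties
  using (∈-applyUpTo⁺; ∈-applyUpTo⁻; ∈-map⁺; ∈-map⁻; ∈-++⁻; ∈-∃++; ∈-tabulate⁺)
open import Data.List.Properties
  using (applyUpTo-∷ʳ; ++-assoc; ++-identityʳ; map-++; map-applyUpTo; tabulate-cong;
    tabulate-lookup; length-applyUpTo; lookup-applyUpTo)
open import Data.List.Relation.Binary.Permutation.Homogeneous using (onIndices)
open import Data.List.Relation.Binary.Permutation.Propositional
  using (_↭_; prep; ↭-refl; ↭-sym; ↭-trans; ↭-reflexive; ↭⇒↭ₛ)
open import Data.List.Relation.Binary.Permutation.Propositional.Properties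
  using (map⁺; shift; ∈-resp-↭; drop-∷; ↭-empty-inv; ++⁺ˡ; ++⁺ʳ; ↭-length; ++⁺; ++-comm)
open import Data.List.Relation.Binary.Permutation.Setoid.Properties using (onIndices-lookup)
open import Data.List.Relation.Unary.All as All using (All; []; _∷_)
import Data.List.Relation.Unary.All.Properties as All
open import Data.List.Relation.Unary.All.Properties using (∷ʳ⁺; ∷ʳ⁻)
open import Data.List.Relation.Unary.Any using (here; there)
open import Data.List.Relation.Unary.Unique.Propositional using (Unique; []; _∷_)
open import Data.List.Relation.Unary.Unique.Propositional.Properties using (applyUpTo⁺₁)
open import Data.Nat
  using (ℕ; zero; suc; pred; _+_; _*_; _∸_; _^_; _≤_; _<_; ∣_-_∣; z≤n; s≤s; s≤s⁻¹; _⊓_; _≡ᵇ_;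
    _≤ᵇ_; NonZero)
open import Data.Nat.DivMod using (_%_; [m+kn]%n≡m%n; m<n⇒m%n≡m)
open import Data.Nat.ListAction using (sum)
open import Data.Nat.ListAction.Properties using (sum-++; sum-↭)
open import Data.Nat.Properties
open import Data.Nat.Tactic.RingSolver using (solve-∀)
open import Data.Product using (∃; ∃-syntax; _×_; _,_; proj₁; proj₂)
open import Data.Sum using (_⊎_; inj₁; inj₂)
open import Data.Unit using (tt)
open import Function using (id; _∘_)
open import Relation.Binary.PropositionalEquality
  using (_≡_; _≢_; refl; sym; trans; cong; cong₂; subst; module ≡-Reasoning; subst₂; setoid)
open import Relation.Nullary using (¬_; yes; no; contradiction)
open import Algebra.Properties.CommutativeMonoid.Sum +-0-commutativeMonoid
  using (sum-syntax; sum-cong-≗; ∑-permute)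

-- The link between both bounds is `travel`: summing response times over requests equals summing,
-- over time, the number of requests still pending. The obstacle for the lower bound is that an
-- arbitrary order may wander, so its moves need not follow any derivation. `Block` absorbs this by
-- recording the head only through its distance to `r j`, where j is the file last read in the open
-- block. Moves over read files change this distance by at most the length moved, so the triangle
-- inequality pays for them. The recursions enter at two events only. When the head enters a new
-- file to the left, the way from `r j` to the left end of the block closes the 𝔉 of j into an ℜ,
-- directly or after a split behind j. When it crosses a skipped file f from the left, j serves as
-- the candidate j′ for the 𝔉 of f. The argument k never has to be tracked: it is determined by the
-- stack and the leftmost position.

range-empty : ∀ {a b} → b ≤ a → range a b ≡ []
range-empty {a} b≤a rewrite m≤n⇒m∸n≡0 b≤a = refl

range-∷ʳ : ∀ {a b} → a ≤ b → range a (suc b) ≡ range a b ∷ʳ b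
range-∷ʳ {a} {b} a≤b = begin
  range a (suc b)                      ≡⟨ cong (applyUpTo (a +_)) (+-∸-assoc 1 a≤b) ⟩
  applyUpTo (a +_) (suc (b ∸ a))       ≡⟨ sym (applyUpTo-∷ʳ (a +_) (b ∸ a)) ⟩
  range a b ∷ʳ (a + (b ∸ a))           ≡⟨ cong (range a b ∷ʳ_) (m+[n∸m]≡n a≤b) ⟩
  range a b ∷ʳ b                       ∎
  where open ≡-Reasoning

range-++ : ∀ {a b c} → a ≤ b → b ≤ c → range a c ≡ range a b ++ range b c
range-++ {a} {b} a≤b b≤c = subst (λ c → range a c ≡ range a b ++ range b c) (m+[n∸m]≡n b≤c) (go _)
  where
  open ≡-Reasoning
  go : ∀ x → range a (b + x) ≡ range a b ++ range b (b + x)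
  go zero rewrite +-identityʳ b | range-empty (≤-refl {b}) = sym (++-identityʳ _)
  go (suc x) rewrite +-suc b x = begin
    range a (suc (b + x))                    ≡⟨ range-∷ʳ (≤-trans a≤b (m≤m+n b x)) ⟩
    range a (b + x) ++ [ b + x ]             ≡⟨ cong (_++ [ b + x ]) (go x) ⟩
    (range a b ++ range b (b + x)) ++ [ b + x ] ≡⟨ ++-assoc (range a b) _ _ ⟩
    range a b ++ (range b (b + x) ++ [ b + x ])
      ≡⟨ cong (range a b ++_) (sym (range-∷ʳ (m≤m+n b x))) ⟩
    range a b ++ range b (suc (b + x))       ∎

∈-range⁺ : ∀ {a b x} → a ≤ x → x < b → x ∈ range a b
∈-range⁺ {a} {b} {x} a≤x x<b =
  subst (_∈ range a b) (m+[n∸m]≡n a≤x) (∈-applyUpTo⁺ (a +_) (∸-monoˡ-< x<b a≤x))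

∈-range⁻ : ∀ {a b x} → x ∈ range a b → a ≤ x × x < b
∈-range⁻ {a} {b} x∈ with ∈-applyUpTo⁻ (a +_) x∈
... | i , i< , refl = m≤m+n a i , (begin-strict
  a + i        <⟨ +-monoʳ-< a i< ⟩
  a + (b ∸ a)  ≡⟨ m+[n∸m]≡n (<⇒≤ (m∸n≢0⇒n<m {b} {a} (m<n⇒n≢0 i<))) ⟩
  b            ∎)
  where open ≤-Reasoning

-- Sums over integer intervals, and minima attained in a list.

Σ[_] : (ℕ → ℕ) → ℕ → ℕ → ℕ
Σ[ g ] a b = sum (map g (range a b))

Σ-empty : ∀ g {a b} → b ≤ a → Σ[ g ] a b ≡ 0
Σ-empty g b≤a rewrite range-empty b≤a = refl

sum-map-++ : ∀ (g : ℕ → ℕ) xs ys → sum (map g (xs ++ ys)) ≡ sum (map g xs) + sum (map g ys)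
sum-map-++ g xs ys = trans (cong sum (map-++ g xs ys)) (sum-++ (map g xs) (map g ys))

Σ-++ : ∀ g {a b c} → a ≤ b → b ≤ c → Σ[ g ] a c ≡ Σ[ g ] a b + Σ[ g ] b c
Σ-++ g {a} {b} {c} a≤b b≤c =
  trans (cong (sum ∘ map g) (range-++ a≤b b≤c)) (sum-map-++ g (range a b) (range b c))

Σ-suc : ∀ g {a b} → a ≤ b → Σ[ g ] a (suc b) ≡ Σ[ g ] a b + g b
Σ-suc g {a} {b} a≤b = begin
  Σ[ g ] a (suc b)                ≡⟨ cong (sum ∘ map g) (range-∷ʳ a≤b) ⟩
  sum (map g (range a b ∷ʳ b))    ≡⟨ sum-map-++ g (range a b) [ b ] ⟩
  Σ[ g ] a b + (g b + 0)          ≡⟨ cong (Σ[ g ] a b +_) (+-identityʳ (g b)) ⟩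
  Σ[ g ] a b + g b                ∎
  where open ≡-Reasoning

minimum≤ : ∀ {x xs} → x ∈ xs → minimum xs ≤ x
minimum≤ {xs = x ∷ xs} (here refl) = min≤⊤ x xs
minimum≤ {xs = x ∷ xs} (there y∈)  = All.lookup (min≤xs x xs) y∈

min-∈ : ∀ x xs → min x xs ∈ x ∷ xs
min-∈ x xs with argmin-sel id x xs
... | inj₁ eq = here eq
... | inj₂ ∈xs = there ∈xs

minimum-∈ : ∀ {x xs} → x ∈ xs → minimum xs ∈ xs
minimum-∈ {xs = x ∷ xs} _ = min-∈ x xs

-- The recursions as upper bounds by candidates and as attained alternatives.

module Recursion (I : LTS) where
  open LTS I public

  W : ℕ → ℕ → ℕ
  W = Σ[ w ]

  W-all : W 0 n ≡ m
  W-all = trans (cong sum (map-applyUpTo id w n)) (sum-extend req)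
    where
    sum-extend : ∀ {N} (f : Fin N → ℕ) → sum (applyUpTo (extend f) N) ≡ ∑[ i < N ] f i
    sum-extend {zero}  f = refl
    sum-extend {suc N} f = cong (f zero +_) (sum-extend (f ∘ suc))

  ℓ-suc : ∀ x → ℓ (suc x) ≡ r x
  ℓ-suc x = Σ-suc s {0} {x} z≤n

  W-single : ∀ i → W i (suc i) ≡ w i
  W-single i = trans (Σ-suc w {i} ≤-refl) (cong (_+ w i) (Σ-empty w {i} ≤-refl))

  𝔉-body : ℕ → ℕ → ℕ → ℕ → ℕ
  𝔉-body i j k j′ = ℜ (suc j′) (pred j) k + 𝔉 i j′ (k′ k (suc j′) (pred j)) + k′ k i (pred j) * d j′ j

  ℜ-body : ℕ → ℕ → ℕ → ℕ → ℕ
  ℜ-body i j k j′ = ℜ j′ j k + ℜ i (pred j′) (k′ k j′ j)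

  𝔉-base : ∀ i k → 𝔉 i i k ≡ k * s i + k′ k i i * s i
  𝔉-base i k = begin
    𝔉 i i k                             ≡⟨ 𝔉-rec i i k ⟩
    𝔉-rhs ℜ 𝔉 i i k
      ≡⟨ cong (λ xs → k * s i + minimum (map (𝔉-body i i k) xs) + k′ k i i * s i) (range-empty {i} ≤-refl) ⟩
    k * s i + 0 + k′ k i i * s i        ≡⟨ cong (_+ k′ k i i * s i) (+-identityʳ (k * s i)) ⟩
    k * s i + k′ k i i * s i            ∎
    where open ≡-Reasoning

  𝔉≤ : ∀ {i j j′} k → i ≤ j′ → j′ < j → 𝔉 i j k ≤ k * s j + 𝔉-body i j k j′ + k′ k i j * s j
  𝔉≤ {i} {j} {j′} k i≤j′ j′<j = begin
    𝔉 i j k          ≡⟨ 𝔉-rec i j k ⟩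
    𝔉-rhs ℜ 𝔉 i j k
      ≤⟨ +-monoˡ-≤ (k′ k i j * s j) (+-monoʳ-≤ (k * s j) (minimum≤ (∈-map⁺ (𝔉-body i j k) (∈-range⁺ i≤j′ j′<j)))) ⟩
    _                ∎
    where open ≤-Reasoning

  d-self : ∀ i → d i i ≡ s i
  d-self i = ∣m-m+n∣≡n (ℓ i) (s i)

  -- Brings the base case of ℜ into the form of the last alternative of its recursion, so that `ℜ≤𝔉`
  -- and `ℜ-cases` also cover i = j.
  ℜ-single : ∀ i k → ℜ i i k ≡ 𝔉 i i k + k′ k i i * d i i
  ℜ-single i k = begin
    ℜ i i k                                      ≡⟨ ℜ-base i k ⟩
    k * s i + 2 * (k ∸ w i) * s i                ≡⟨ lemma (k * s i) (k ∸ w i) (s i) ⟩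
    k * s i + (k ∸ w i) * s i + (k ∸ w i) * s i
      ≡⟨ cong₂ (λ a b → k * s i + (k ∸ a) * s i + (k ∸ a) * b) (sym (W-single i)) (sym (d-self i)) ⟩
    k * s i + k′ k i i * s i + k′ k i i * d i i  ≡⟨ cong (_+ k′ k i i * d i i) (sym (𝔉-base i k)) ⟩
    𝔉 i i k + k′ k i i * d i i                   ∎
    where
    open ≡-Reasoning
    lemma : ∀ a b c → a + 2 * b * c ≡ a + b * c + b * c
    lemma = solve-∀

  ℜ≤𝔉 : ∀ {i j} k → i ≤ j → ℜ i j k ≤ 𝔉 i j k + k′ k i j * d j i
  ℜ≤𝔉 {i} {j} k i≤j with m≤n⇒m<n∨m≡n i≤j
  ... | inj₁ i<j  = ≤-trans (≤-reflexive (ℜ-rec k i<j)) (min≤⊤ _ (map (ℜ-body i j k) (range (suc i) (suc j))))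
  ... | inj₂ refl = ≤-reflexive (ℜ-single i k)

  ℜ≤split : ∀ {i j j′} k → i < j′ → j′ ≤ j → ℜ i j k ≤ ℜ-body i j k j′
  ℜ≤split {i} {j} k i<j′ j′≤j = ≤-trans (≤-reflexive (ℜ-rec k (<-≤-trans i<j′ j′≤j)))
    (All.lookup (min≤xs _ (map (ℜ-body i j k) (range (suc i) (suc j)))) (∈-map⁺ (ℜ-body i j k) (∈-range⁺ i<j′ (s≤s j′≤j))))

  ℜ-cases : ∀ {i j} k → i ≤ j → (ℜ i j k ≡ 𝔉 i j k + k′ k i j * d j i)
            ⊎ (∃[ j′ ] i < j′ × j′ ≤ j × ℜ i j k ≡ ℜ-body i j k j′)
  ℜ-cases {i} {j} k i≤j with m≤n⇒m<n∨m≡n i≤j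
  ... | inj₂ refl = inj₁ (ℜ-single i k)
  ... | inj₁ i<j with argmin-sel id (𝔉 i j k + k′ k i j * d j i) (map (ℜ-body i j k) (range (suc i) (suc j)))
  ... | inj₁ eq = inj₁ (trans (ℜ-rec k i<j) eq)
  ... | inj₂ ∈xs with ∈-map⁻ (ℜ-body i j k) ∈xs
  ... | j′ , j′∈ , eq with ∈-range⁻ {suc i} {suc j} j′∈
  ... | i<j′ , j′<1+j = inj₂ (j′ , i<j′ , s≤s⁻¹ j′<1+j , trans (ℜ-rec k i<j) eq)

  𝔉-cases : ∀ {i j} k → i < j → ∃[ j′ ] i ≤ j′ × j′ < j
            × 𝔉 i j k ≡ k * s j + 𝔉-body i j k j′ + k′ k i j * s j
  𝔉-cases {i} {j} k i<j with ∈-map⁻ (𝔉-body i j k) {xs = range i j} (minimum-∈ (∈-map⁺ (𝔉-body i j k) (∈-range⁺ {i} ≤-refl i<j)))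
  ... | j′ , j′∈ , eq with ∈-range⁻ {i} {j} j′∈
  ... | i≤j′ , j′<j = j′ , i≤j′ , j′<j ,
        trans (𝔉-rec i j k) (cong (λ x → k * s j + x + k′ k i j * s j) eq)

∣-∣-+ : ∀ {a b} c → a ≤ b → b ≤ c → ∣ a - c ∣ ≡ ∣ a - b ∣ + ∣ b - c ∣
∣-∣-+ {a} {b} c a≤b b≤c rewrite m≤n⇒∣m-n∣≡n∸m a≤b | m≤n⇒∣m-n∣≡n∸m b≤c | m≤n⇒∣m-n∣≡n∸m (≤-trans a≤b b≤c) =
  sym (trans (+-comm (b ∸ a) (c ∸ b)) (m∸n+n∸o b≤c a≤b))
  where
  m∸n+n∸o : ∀ {m n o} → n ≤ m → o ≤ n → (m ∸ n) + (n ∸ o) ≡ m ∸ o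
  m∸n+n∸o {m} {n} {o} n≤m o≤n = trans (sym (+-∸-assoc (m ∸ n) o≤n)) (cong (_∸ o) (m∸n+n≡m n≤m))

remove-∈ : ∀ {a} {A : Set a} {x : A} {xs} → x ∈ xs → ∃[ ys ] xs ↭ x ∷ ys
remove-∈ {x = x} x∈ with ∈-∃++ x∈
... | ys , zs , refl = ys ++ zs , shift x ys zs

-- The elements of `xs` are removed from ρ one by one; being distinct, the later ones survive each
-- removal. The rest `e` collects whatever else ρ contains, repetitions included.
⊆⇒↭ : ∀ {a} {A : Set a} {xs ρ : List A} → Unique xs → All (_∈ ρ) xs → ∃[ e ] ρ ↭ xs ++ e
⊆⇒↭ {ρ = ρ} [] [] = ρ , ↭-refl
⊆⇒↭ {xs = x ∷ xs} (x∉xs ∷ xs!) (x∈ρ ∷ xs⊆ρ) with remove-∈ x∈ρ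
... | ρ′ , ρ↭ with ⊆⇒↭ {ρ = ρ′} xs! (All.zipWith (λ (x≢y , y∈ρ) → tail-∈ x≢y (∈-resp-↭ ρ↭ y∈ρ)) (x∉xs , xs⊆ρ))
  where
  tail-∈ : ∀ {y} → x ≢ y → y ∈ x ∷ ρ′ → y ∈ ρ′
  tail-∈ x≢y (here y≡x) = contradiction (sym y≡x) x≢y
  tail-∈ x≢y (there y∈) = y∈
... | e , ρ′↭ = e , ↭-trans ρ↭ (prep x ρ′↭)

shift-past : ∀ {a} {A : Set a} (x : A) xs ys zs → (xs ++ x ∷ ys) ++ zs ↭ (xs ++ ys) ++ x ∷ zs
shift-past x xs ys zs = ↭-trans (++⁺ʳ zs (shift x xs ys)) (↭-sym (shift x (xs ++ ys) zs))

-- Lower bound: the cost of any order dominates a potential of the head's state.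

module LowerBound (I : LTS) where
  open Recursion I public

  weight : List ℕ → ℕ
  weight xs = sum (map w xs)

  -- The cost of moving the head from p through the files of ρ to q, where every unit of
  -- time is charged the number of pending requests, which is k at the start.
  travel : ℕ → List ℕ → ℕ → ℕ → ℕ
  travel p []      k q = k * ∣ q - p ∣
  travel p (f ∷ ρ) k q = k * ∣ ℓ f - p ∣ + (k ∸ w f) * s f + travel (r f) ρ (k ∸ w f) q

  ℓ-mono : ∀ {a b} → a ≤ b → ℓ a ≤ ℓ b
  ℓ-mono {a} {b} a≤b = m+n≤o⇒m≤o (ℓ a) (≤-reflexive (sym (Σ-++ s {0} z≤n a≤b)))

  top : List ℕ → ℕ
  top []      = n
  top (f ∷ _) = f

  -- A stack holds the skipped files in increasing order.  When y is the leftmost position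
  -- visited and all files from y to below top u are read, pending u y requests are pending.
  data Stack : List ℕ → Set where
    []  : Stack []
    _∷_ : ∀ {f u} → f < top u → Stack u → Stack (f ∷ u)

  top≤n : ∀ {u} → Stack u → top u ≤ n
  top≤n []          = ≤-refl
  top≤n (f<top ∷ S) = <⇒≤ (<-≤-trans f<top (top≤n S))

  top≤ : ∀ {u} → Stack u → All (top u ≤_) u
  top≤ []          = []
  top≤ (f<top ∷ S) = ≤-refl ∷ All.map (≤-trans (<⇒≤ f<top)) (top≤ S)

  pending : List ℕ → ℕ → ℕ
  pending u y = W 0 y + weight u

  -- base u charges, for each skipped file f, the ℜ that reads the files between f and the
  -- next skipped file and the crossing of f from the right, which starts the 𝔉 of f.
  base : List ℕ → ℕ
  base []      = 0
  base (f ∷ u) = base u + ℜ (suc f) (pred (top u)) (pending u (top u)) + pending (f ∷ u) f * s f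

  -- Skipping `f` only moves its request from the left part to the stack.
  pending-push : ∀ u f → pending (f ∷ u) f ≡ pending u (suc f)
  pending-push u f = trans (sym (+-assoc (W 0 f) (w f) (weight u))) (cong (_+ weight u) (sym (Σ-suc w {0} {f} z≤n)))

  -- This determines k in every recursive call: reading a, ..., b leaves the requests left of a and
  -- those on the stack. The truncated subtraction is exact, since the files removed are among those
  -- counted.
  pending-k′ : ∀ u {a b} → a ≤ suc b → k′ (pending u (suc b)) a b ≡ pending u a
  pending-k′ u {a} {b} a≤ = begin
    W 0 (suc b) + weight u ∸ W a (suc b)
      ≡⟨ cong (λ x → x + weight u ∸ W a (suc b)) (trans (Σ-++ w {0} {a} z≤n a≤) (+-comm (W 0 a) (W a (suc b)))) ⟩
    W a (suc b) + W 0 a + weight u ∸ W a (suc b)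
      ≡⟨ cong (_∸ W a (suc b)) (+-assoc (W a (suc b)) (W 0 a) (weight u)) ⟩
    W a (suc b) + (pending u a) ∸ W a (suc b)    ≡⟨ m+n∸m≡n (W a (suc b)) (pending u a) ⟩
    pending u a                                  ∎
    where open ≡-Reasoning

  pending-k′-pred : ∀ u {a b} → 0 < b → a ≤ b → k′ (pending u b) a (pred b) ≡ pending u a
  pending-k′-pred u {b = suc b} _ a≤ = pending-k′ u a≤

  -- The files from y to below top u are read, with head at p and cost A so far; j is the file
  -- among them that was read last.
  data Block (u : List ℕ) (y p A : ℕ) : Set where
    empty : y ≡ top u → base u ≤ A → Block u y p A
    read  : ∀ j → y ≤ j → j < top u →
            base u + (ℜ (suc j) (pred (top u)) (pending u (top u)) + 𝔉 y j (pending u (suc j))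
                      + pending u y * ∣ ℓ p - r j ∣) ≤ A →
            Block u y p A

  -- The way from `r j` to `ℓ y` completes the open 𝔉 of j. If j is the last file below `top u`,
  -- this is the final alternative of ℜ; otherwise it is combined with the split of ℜ at `suc j`.
  block-ℜ : ∀ u {y j} → y ≤ j → j < top u →
            ℜ y (pred (top u)) (pending u (top u)) ≤
            ℜ (suc j) (pred (top u)) (pending u (top u)) + 𝔉 y j (pending u (suc j)) + pending u y * d j y
  block-ℜ u {y} {j} y≤j j<t with top u
  ... | suc b with m≤n⇒m<n∨m≡n (s≤s⁻¹ j<t)
  ... | inj₂ refl = begin
    ℜ y j (pending u (suc j))                                              ≤⟨ ℜ≤𝔉 _ y≤j ⟩
    𝔉 y j (pending u (suc j)) + k′ (pending u (suc j)) y j * d j y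
      ≡⟨ cong (λ x → 𝔉 y j (pending u (suc j)) + x * d j y) (pending-k′ u (m≤n⇒m≤1+n y≤j)) ⟩
    𝔉 y j (pending u (suc j)) + pending u y * d j y
      ≤⟨ +-monoˡ-≤ _ (m≤n+m _ (ℜ (suc j) j (pending u (suc j)))) ⟩
    _ ∎
    where open ≤-Reasoning
  ... | inj₁ j<b = begin
    ℜ y b K
      ≤⟨ ℜ≤split K (s≤s y≤j) j<b ⟩
    ℜ (suc j) b K + ℜ y j (k′ K (suc j) b)
      ≡⟨ cong (λ x → ℜ (suc j) b K + ℜ y j x) (pending-k′ u (m≤n⇒m≤1+n j<b)) ⟩
    ℜ (suc j) b K + ℜ y j (pending u (suc j))
      ≤⟨ +-monoʳ-≤ (ℜ (suc j) b K) (ℜ≤𝔉 _ y≤j) ⟩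
    ℜ (suc j) b K + (𝔉 y j (pending u (suc j)) + k′ (pending u (suc j)) y j * d j y)
      ≡⟨ cong (λ x → ℜ (suc j) b K + (𝔉 y j (pending u (suc j)) + x * d j y)) (pending-k′ u (m≤n⇒m≤1+n y≤j)) ⟩
    ℜ (suc j) b K + (𝔉 y j (pending u (suc j)) + pending u y * d j y)
      ≡⟨ sym (+-assoc (ℜ (suc j) b K) _ _) ⟩
    _ ∎
    where
    open ≤-Reasoning
    K : ℕ
    K = pending u (suc b)

  -- The side condition excludes `y ≡ top u ≡ 0`, where `pred` truncates and `ℜ 0 0` would mean file
  -- 0 instead of no file.
  block-base : ∀ {u y A} → Block u y y A → (y ≡ top u → 0 < y) →
               base u + ℜ y (pred (top u)) (pending u (top u)) ≤ A
  block-base {u} {suc y} {A} (empty eq h) _ rewrite sym eq = begin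
    base u + ℜ (suc y) y (pending u (suc y))  ≡⟨ cong (base u +_) (ℜ-empty _ (n<1+n y)) ⟩
    base u + 0                                ≡⟨ +-identityʳ (base u) ⟩
    base u                                    ≤⟨ h ⟩
    A                                         ∎
    where open ≤-Reasoning
  block-base {u} {zero} (empty eq h) y>0 = contradiction (y>0 eq) (n≮n 0)
  block-base {u} (read j y≤j j<t h) _ = ≤-trans (+-monoʳ-≤ (base u) (block-ℜ u y≤j j<t)) h

  -- Once f is crossed it is the file last read, and the block below it merges with the part between
  -- f and the next skipped file. Its 𝔉 takes the former j as candidate, or its base case if nothing
  -- below f was read. The charge `k * s f` pays for this second crossing; the first one is
  -- contained in `base (f ∷ u)`.
  close : ∀ {f u y A k} → y ≤ f → f < top u → pending u y ≤ k →
          Block (f ∷ u) y f A → Block u y (suc f) (A + k * s f)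
  close {f} {u} {y} {A} {k} y≤f f<t K≤k B = read f y≤f f<t (begin
    base u + (R₀ + 𝔉 y f k₀ + K * ∣ ℓ (suc f) - r f ∣)
      ≡⟨ cong (λ x → base u + (R₀ + 𝔉 y f k₀ + K * x)) (m≡n⇒∣m-n∣≡0 (ℓ-suc f)) ⟩
    base u + (R₀ + 𝔉 y f k₀ + K * 0)
      ≡⟨ cong (λ x → base u + (R₀ + 𝔉 y f k₀ + x)) (*-zeroʳ K) ⟩
    base u + (R₀ + 𝔉 y f k₀ + 0)                        ≡⟨ cong (base u +_) (+-identityʳ _) ⟩
    base u + (R₀ + 𝔉 y f k₀)                            ≤⟨ bound B ⟩
    A + K * s f                                         ≤⟨ +-monoʳ-≤ A (*-monoˡ-≤ (s f) K≤k) ⟩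
    A + k * s f                                         ∎)
    where
    open ≤-Reasoning
    R₀ k₀ K : ℕ
    R₀ = ℜ (suc f) (pred (top u)) (pending u (top u))
    k₀ = pending u (suc f)
    K  = pending u y
    after : k′ k₀ y f ≡ K
    after = pending-k′ u (m≤n⇒m≤1+n y≤f)
    bound : Block (f ∷ u) y f A → base u + (R₀ + 𝔉 y f k₀) ≤ A + K * s f
    bound (empty refl h) = begin
      base u + (R₀ + 𝔉 f f k₀)
        ≡⟨ cong (λ x → base u + (R₀ + x)) (𝔉-base f k₀) ⟩
      base u + (R₀ + (k₀ * s f + k′ k₀ f f * s f))
        ≡⟨ lemma (base u) R₀ (k₀ * s f) (k′ k₀ f f * s f) ⟩
      base u + R₀ + k₀ * s f + k′ k₀ f f * s f
        ≡⟨ cong₂ (λ a b → base u + R₀ + a * s f + b * s f) (sym (pending-push u f)) after ⟩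
      base (f ∷ u) + K * s f                          ≤⟨ +-monoˡ-≤ (K * s f) h ⟩
      A + K * s f                                     ∎
      where
      lemma : ∀ a b c e → a + (b + (c + e)) ≡ a + b + c + e
      lemma = solve-∀
    bound (read j y≤j j<f h) = begin
      base u + (R₀ + 𝔉 y f k₀)
        ≤⟨ +-monoʳ-≤ (base u) (+-monoʳ-≤ R₀ (𝔉≤ k₀ y≤j j<f)) ⟩
      base u + (R₀ + (k₀ * s f + 𝔉-body y f k₀ j + k′ k₀ y f * s f))
        ≡⟨ lemma (base u) R₀ (k₀ * s f) (𝔉-body y f k₀ j) (k′ k₀ y f * s f) ⟩
      base u + R₀ + k₀ * s f + 𝔉-body y f k₀ j + k′ k₀ y f * s f
        ≡⟨ cong (λ x → base u + R₀ + x * s f + 𝔉-body y f x j + k′ k₀ y f * s f) (sym (pending-push u f)) ⟩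
      base (f ∷ u) + 𝔉-body y f k₁ j + k′ k₀ y f * s f
        ≡⟨ cong₂ (λ a b → base (f ∷ u) + a + b * s f) body after ⟩
      base (f ∷ u) + (ℜ (suc j) (pred f) k₁ + 𝔉 y j (pending (f ∷ u) (suc j))
                      + pending (f ∷ u) y * ∣ ℓ f - r j ∣) + K * s f  ≤⟨ +-monoˡ-≤ (K * s f) h ⟩
      A + K * s f                                                    ∎
      where
      k₁ : ℕ
      k₁ = pending (f ∷ u) f
      lemma : ∀ a b c e g → a + (b + (c + e + g)) ≡ a + b + c + e + g
      lemma = solve-∀
      0<f : 0 < f
      0<f = ≤-<-trans z≤n j<f
      body : 𝔉-body y f k₁ j ≡ ℜ (suc j) (pred f) k₁ + 𝔉 y j (pending (f ∷ u) (suc j))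
                               + pending (f ∷ u) y * ∣ ℓ f - r j ∣
      body = cong₂ (λ a b → ℜ (suc j) (pred f) k₁ + 𝔉 y j a + b * ∣ ℓ f - r j ∣)
                   (pending-k′-pred (f ∷ u) 0<f j<f) (pending-k′-pred (f ∷ u) 0<f y≤f)

  -- Only the distance to `r j` depends on the head, and it grows by at most the distance moved. An
  -- empty block ignores the head, so there the charge is given away.
  shift-head : ∀ {u y p q A k δ} → pending u y ≤ k → ∣ ℓ q - ℓ p ∣ ≤ δ →
               Block u y p A → Block u y q (A + k * δ)
  shift-head {A = A} {k} {δ} _ _ (empty eq h) = empty eq (≤-trans h (m≤m+n A (k * δ)))
  shift-head {u} {y} {p} {q} {A} {k} {δ} K≤k dist≤ (read j y≤j j<t h) = read j y≤j j<t (begin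
    base u + (X + K * ∣ ℓ q - r j ∣)
      ≤⟨ +-monoʳ-≤ (base u) (+-monoʳ-≤ X (*-monoʳ-≤ K (∣-∣-triangle (ℓ q) (ℓ p) (r j)))) ⟩
    base u + (X + K * (∣ ℓ q - ℓ p ∣ + ∣ ℓ p - r j ∣))
      ≡⟨ lemma (base u) X K ∣ ℓ q - ℓ p ∣ ∣ ℓ p - r j ∣ ⟩
    base u + (X + K * ∣ ℓ p - r j ∣) + K * ∣ ℓ q - ℓ p ∣   ≤⟨ +-mono-≤ h (*-mono-≤ K≤k dist≤) ⟩
    A + k * δ                                              ∎)
    where
    open ≤-Reasoning
    K X : ℕ
    K = pending u y
    X = ℜ (suc j) (pred (top u)) (pending u (top u)) + 𝔉 y j (pending u (suc j))
    lemma : ∀ a b c e g → a + (b + c * (e + g)) ≡ a + (b + c * g) + c * e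
    lemma = solve-∀

  -- With the head at its left end the block closes into an ℜ. This ℜ and the crossing of q from the
  -- right are the two terms by which `base (q ∷ u)` exceeds `base u`.
  skip-file : ∀ {q u A k} → pending u (suc q) ≤ k → Block u (suc q) (suc q) A → Block (q ∷ u) q q (A + k * s q)
  skip-file {q} {u} {A} {k} K≤k B = empty refl
    (+-mono-≤ (block-base B (λ _ → s≤s z≤n)) (*-monoˡ-≤ (s q) (≤-trans (≤-reflexive (pending-push u q)) K≤k)))

  record Config (ρ : List ℕ) (p : ℕ) : Set where
    constructor config
    field
      {skipped}  : List ℕ
      {leftmost} : ℕ
      {extra}    : List ℕ  -- crossed, but still to come in ρ
      stack      : Stack skipped
      left≤      : leftmost ≤ p
      ≤top       : p ≤ top skipped
      unread     : ρ ↭ (range 0 leftmost ++ skipped) ++ extra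

  open Config

  owed : ∀ {ρ p} → Config ρ p → ℕ
  owed C = pending (skipped C) (leftmost C)

  Paid : ∀ {ρ p} → Config ρ p → ℕ → Set
  Paid {p = p} C A = Block (skipped C) (leftmost C) p A

  owed≤weight : ∀ {ρ p} (C : Config ρ p) → owed C ≤ weight ρ
  owed≤weight {ρ} C = begin
    W 0 y + weight u                      ≡⟨ sym (sum-map-++ w (range 0 y) u) ⟩
    weight (range 0 y ++ u)               ≤⟨ m≤m+n _ (weight (extra C)) ⟩
    weight (range 0 y ++ u) + weight (extra C) ≡⟨ sym (sum-map-++ w (range 0 y ++ u) (extra C)) ⟩
    weight ((range 0 y ++ u) ++ extra C)  ≡⟨ sym (sum-↭ (map⁺ w (unread C))) ⟩
    weight ρ                              ∎
    where
    open ≤-Reasoning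
    y = leftmost C
    u = skipped C

  -- The multiplier k is left open because a crossing is charged in two ways: on the way to a file
  -- by the weight of everything still to come, and while a file is being read without that file.
  step-right : ∀ {ρ p A} (C : Config ρ p) → p < n → Paid C A →
               ∃[ C′ ] leftmost C′ ≤ p × (∀ {k} → owed C′ ≤ k → Paid {ρ} {suc p} C′ (A + k * s p))
  step-right {p = p} (config S l≤ ≤t ρ↭) p<n B with m≤n⇒m<n∨m≡n ≤t
  ... | inj₁ p<t = config S (m≤n⇒m≤1+n l≤) p<t ρ↭ , l≤ , λ K≤k →
        shift-head K≤k (≤-reflexive (trans (cong (λ x → ∣ x - ℓ p ∣) (ℓ-suc p)) (∣m+n-m∣≡n (ℓ p) (s p)))) B
    where
    ∣m+n-m∣≡n : ∀ m n → ∣ m + n - m ∣ ≡ n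
    ∣m+n-m∣≡n m n = trans (∣-∣-comm (m + n) m) (∣m-m+n∣≡n m n)
  step-right (config [] l≤ ≤t ρ↭) p<n B | inj₂ refl = contradiction p<n (n≮n _)
  step-right {ρ} {p} (config {leftmost = y} {e} (_∷_ {u = u} p<t S) l≤ ≤t ρ↭) p<n B | inj₂ refl =
    -- The crossed file leaves the stack, but ρ still names it, so it becomes `extra`.
    config {extra = p ∷ e} S (m≤n⇒m≤1+n l≤) p<t (↭-trans ρ↭ (shift-past p (range 0 y) u e)) , l≤ , λ K≤k → close l≤ p<t K≤k B

  -- Left of the leftmost position a file is entered for the first time and becomes a skipped one.
  -- Elsewhere the head only passes files already read.
  step-left : ∀ {ρ q A} (C : Config ρ (suc q)) → Paid C A →
              ∃[ C′ ] Paid {ρ} {q} C′ (A + weight ρ * s q)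
  step-left {ρ} {q} C@(config {u} {y} {e} S l≤ ≤t ρ↭) B with m≤n⇒m<n∨m≡n l≤
  ... | inj₁ l<1+q = config S (s≤s⁻¹ l<1+q) (<⇒≤ ≤t) ρ↭ ,
        shift-head (owed≤weight C) (≤-reflexive (trans (cong (λ x → ∣ ℓ q - x ∣) (ℓ-suc q)) (∣m-m+n∣≡n (ℓ q) (s q)))) B
  ... | inj₂ refl = config (≤t ∷ S) ≤-refl ≤-refl (↭-trans ρ↭ (↭-reflexive (cong (_++ e) regroup))) ,
        skip-file (owed≤weight C) B
    where
    regroup : range 0 (suc q) ++ u ≡ range 0 q ++ q ∷ u
    regroup = trans (cong (_++ u) (range-∷ʳ {0} {q} z≤n)) (++-assoc (range 0 q) [ q ] u)

  go-right : ∀ {ρ} x {p A} (C : Config ρ p) → p + x ≤ n → Paid C A →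
             ∃[ C′ ] Paid {ρ} {p + x} C′ (A + weight ρ * ∣ ℓ (p + x) - ℓ p ∣)
  go-right zero {p} {A} C _ B rewrite +-identityʳ p = C , shift-head (owed≤weight C) ≤-refl B
  go-right {ρ} (suc x) {p} {A} C ≤n B rewrite +-suc p x
    with step-right C (<-≤-trans (s≤s (m≤m+n p x)) ≤n) B
  ... | C₁ , _ , B₁ with go-right x C₁ ≤n (B₁ (owed≤weight C₁))
  ... | C₂ , B₂ = C₂ , subst (Paid C₂) total B₂
    where
    open ≡-Reasoning
    total : A + weight ρ * s p + weight ρ * ∣ ℓ (suc p + x) - ℓ (suc p) ∣ ≡ A + weight ρ * ∣ ℓ (suc (p + x)) - ℓ p ∣
    total = begin
      A + weight ρ * s p + weight ρ * ∣ ℓ (suc p + x) - ℓ (suc p) ∣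
        ≡⟨ lemma A (weight ρ) (s p) _ ⟩
      A + weight ρ * (s p + ∣ ℓ (suc p + x) - ℓ (suc p) ∣)
        ≡⟨ cong (λ z → A + weight ρ * z) (cong₂ _+_ (sym edge) (∣-∣-comm (ℓ (suc p + x)) (ℓ (suc p)))) ⟩
      A + weight ρ * (∣ ℓ p - ℓ (suc p) ∣ + ∣ ℓ (suc p) - ℓ (suc p + x) ∣)
        ≡⟨ cong (λ z → A + weight ρ * z) (sym (∣-∣-+ (ℓ (suc p + x)) (ℓ-mono (n≤1+n p)) (ℓ-mono (m≤m+n (suc p) x)))) ⟩
      A + weight ρ * ∣ ℓ p - ℓ (suc (p + x)) ∣
        ≡⟨ cong (λ z → A + weight ρ * z) (∣-∣-comm (ℓ p) (ℓ (suc p + x))) ⟩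
      A + weight ρ * ∣ ℓ (suc (p + x)) - ℓ p ∣                         ∎
      where
      edge : ∣ ℓ p - ℓ (suc p) ∣ ≡ s p
      edge = trans (cong (λ z → ∣ ℓ p - z ∣) (ℓ-suc p)) (∣m-m+n∣≡n (ℓ p) (s p))
      lemma : ∀ a b c e → a + b * c + b * e ≡ a + b * (c + e)
      lemma = solve-∀

  go-left : ∀ {ρ} x {p A} (C : Config ρ (x + p)) → Paid C A →
            ∃[ C′ ] Paid {ρ} {p} C′ (A + weight ρ * ∣ ℓ p - ℓ (x + p) ∣)
  go-left zero C B = C , shift-head (owed≤weight C) ≤-refl B
  go-left {ρ} (suc x) {p} {A} C B with step-left C B
  ... | C₁ , B₁ with go-left x C₁ B₁
  ... | C₂ , B₂ = C₂ , subst (Paid C₂) total B₂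
    where
    open ≡-Reasoning
    q : ℕ
    q = x + p
    total : A + weight ρ * s q + weight ρ * ∣ ℓ p - ℓ q ∣ ≡ A + weight ρ * ∣ ℓ p - ℓ (suc q) ∣
    total = begin
      A + weight ρ * s q + weight ρ * ∣ ℓ p - ℓ q ∣             ≡⟨ lemma A (weight ρ) (s q) _ ⟩
      A + weight ρ * (∣ ℓ p - ℓ q ∣ + s q)
        ≡⟨ cong (λ z → A + weight ρ * (∣ ℓ p - ℓ q ∣ + z)) (sym edge) ⟩
      A + weight ρ * (∣ ℓ p - ℓ q ∣ + ∣ ℓ q - ℓ (suc q) ∣)
        ≡⟨ cong (λ z → A + weight ρ * z) (sym (∣-∣-+ (ℓ (suc q)) (ℓ-mono (m≤n+m p x)) (ℓ-mono (n≤1+n q)))) ⟩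
      A + weight ρ * ∣ ℓ p - ℓ (suc q) ∣                        ∎
      where
      edge : ∣ ℓ q - ℓ (suc q) ∣ ≡ s q
      edge = trans (cong (λ z → ∣ ℓ q - z ∣) (ℓ-suc q)) (∣m-m+n∣≡n (ℓ q) (s q))
      lemma : ∀ a b c e → a + b * c + b * e ≡ a + b * (e + c)
      lemma = solve-∀

  go-to : ∀ {ρ p A} q (C : Config ρ p) → q ≤ n → Paid C A →
          ∃[ C′ ] Paid {ρ} {q} C′ (A + weight ρ * ∣ ℓ q - ℓ p ∣)
  go-to {p = p} q C q≤n B with ≤-total p q
  ... | inj₁ p≤q with m≤n⇒∃[o]m+o≡n p≤q
  ...   | x , refl = go-right x C q≤n B
  go-to {p = p} q C q≤n B | inj₂ q≤p with m≤n⇒∃[o]m+o≡n q≤p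
  ...   | x , refl rewrite +-comm q x = go-left x C B

  read-file : ∀ {f ρ A} (C : Config (f ∷ ρ) f) → f < n → Paid C A →
              ∃[ C′ ] Paid {ρ} {suc f} C′ (A + weight ρ * s f)
  read-file {f} {ρ} C f<n B with step-right C f<n B
  ... | config {u} {y} {e} S l≤ ≤t ρ↭ , y≤f , B₁ with remove-∈ f∈e
    where
    -- Just crossed, f is neither left of the leftmost position nor on the stack, whose files all
    -- lie further right.
    f∈e : f ∈ e
    f∈e with ∈-++⁻ (range 0 y ++ u) (∈-resp-↭ ρ↭ (here refl))
    ... | inj₂ f∈ = f∈
    ... | inj₁ f∈v with ∈-++⁻ (range 0 y) f∈v
    ...   | inj₁ f∈y = contradiction (proj₂ (∈-range⁻ {0} {y} f∈y)) (≤⇒≯ y≤f)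
    ...   | inj₂ f∈u = contradiction (All.lookup (top≤ S) f∈u) (<⇒≱ ≤t)
  ... | e′ , e↭ = C′ , B₁ (owed≤weight C′)
    where
    C′ : Config ρ (suc f)
    C′ = config {extra = e′} S l≤ ≤t (drop-∷ (↭-trans ρ↭
           (↭-trans (++⁺ˡ (range 0 y ++ u) e↭) (shift f (range 0 y ++ u) e′))))

  -- An exhausted order leaves an empty stack and leftmost position 0, so nothing is pending and the
  -- return to file 0 is free. The block cannot be `empty`, because `top []` is n > 0.
  finish : ∀ {p A} (C : Config [] p) → Paid C A → ℜ 0 last (pending [] n) ≤ A
  finish (config {[]} {zero} _ _ _ _) (read j 0≤j j<n h) = ≤-trans (block-ℜ [] 0≤j j<n) h
  finish (config {_ ∷ _} {zero} _ _ _ []↭) _ with () ← ↭-empty-inv (↭-sym []↭)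
  finish (config {_} {suc _} _ _ _ []↭) _ with () ← ↭-empty-inv (↭-sym []↭)

  ℜ≤travel : ∀ {ρ p A} q (C : Config ρ p) → All (_< n) ρ → Paid C A →
             ℜ 0 last (pending [] n) ≤ A + travel (ℓ p) ρ (weight ρ) q
  ℜ≤travel {[]} {A = A} q C [] B = ≤-trans (finish C B) (m≤m+n A 0)
  ℜ≤travel {f ∷ ρ} {p} {A} q C (f<n ∷ ρ<n) B
    with go-to f C (<⇒≤ f<n) B
  ... | C₁ , B₁ with read-file C₁ f<n B₁
  ... | C₂ , B₂ = ≤-trans (ℜ≤travel q C₂ ρ<n B₂) (≤-reflexive (begin
    A + k * ∣ ℓ f - ℓ p ∣ + weight ρ * s f + travel (ℓ (suc f)) ρ (weight ρ) q
      ≡⟨ cong (λ x → A + k * ∣ ℓ f - ℓ p ∣ + weight ρ * s f + travel x ρ (weight ρ) q) (ℓ-suc f) ⟩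
    A + k * ∣ ℓ f - ℓ p ∣ + weight ρ * s f + travel (r f) ρ (weight ρ) q
      ≡⟨ cong (λ x → A + k * ∣ ℓ f - ℓ p ∣ + x * s f + travel (r f) ρ x q) (sym (m+n∸m≡n (w f) (weight ρ))) ⟩
    A + k * ∣ ℓ f - ℓ p ∣ + (k ∸ w f) * s f + travel (r f) ρ (k ∸ w f) q
      ≡⟨ lemma A _ _ _ ⟩
    A + travel (ℓ p) (f ∷ ρ) k q  ∎))
    where
    open ≡-Reasoning
    k : ℕ
    k = weight (f ∷ ρ)
    lemma : ∀ a b c e → a + b + c + e ≡ a + (b + c + e)
    lemma = solve-∀

  -- The head starts at `ℓ n`, which is L, with every file on its left and nothing charged. Any
  -- surplus of ρ over one copy of each file starts in `extra`.
  lower-bound : ∀ {ρ} q → All (_< n) ρ → (∀ {x} → x < n → x ∈ ρ) →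
                ℜ 0 last (pending [] n) ≤ travel L ρ (weight ρ) q
  lower-bound {ρ} q ρ<n all∈ with ⊆⇒↭ {xs = range 0 n} {ρ} unique (All.tabulate (λ x∈ → all∈ (proj₂ (∈-range⁻ {0} {n} x∈))))
    where
    unique : Unique (range 0 n)
    unique = applyUpTo⁺₁ id n (λ i<j _ → <⇒≢ i<j)
  ... | e , ρ↭ = subst (λ x → ℜ 0 last (pending [] n) ≤ travel x ρ (weight ρ) q) (ℓ-suc last)
    (ℜ≤travel q (config {extra = e} [] ≤-refl ≤-refl
      (↭-trans ρ↭ (↭-reflexive (cong (_++ e) (sym (++-identityʳ (range 0 n))))))) ρ<n (empty refl z≤n))

-- Upper bound: tours realising ℜ and 𝔉.

module UpperBound (I : LTS) where
  open LowerBound I public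

  travel-via : ∀ p x ρ k q → travel p ρ k q ≤ k * ∣ x - p ∣ + travel x ρ k q
  travel-via p x [] k q = begin
    k * ∣ q - p ∣                      ≤⟨ *-monoʳ-≤ k (∣-∣-triangle q x p) ⟩
    k * (∣ q - x ∣ + ∣ x - p ∣)        ≡⟨ lemma k ∣ q - x ∣ ∣ x - p ∣ ⟩
    k * ∣ x - p ∣ + k * ∣ q - x ∣      ∎
    where
    open ≤-Reasoning
    lemma : ∀ a b c → a * (b + c) ≡ a * c + a * b
    lemma = solve-∀
  travel-via p x (f ∷ ρ) k q = begin
    k * ∣ ℓ f - p ∣ + (k ∸ w f) * s f + V
      ≤⟨ +-monoˡ-≤ V (+-monoˡ-≤ ((k ∸ w f) * s f) (*-monoʳ-≤ k (∣-∣-triangle (ℓ f) x p))) ⟩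
    k * (∣ ℓ f - x ∣ + ∣ x - p ∣) + (k ∸ w f) * s f + V
      ≡⟨ lemma k ∣ ℓ f - x ∣ ∣ x - p ∣ ((k ∸ w f) * s f) V ⟩
    k * ∣ x - p ∣ + (k * ∣ ℓ f - x ∣ + (k ∸ w f) * s f + V)  ∎
    where
    open ≤-Reasoning
    V : ℕ
    V = travel (r f) ρ (k ∸ w f) q
    lemma : ∀ a b c e g → a * (b + c) + e + g ≡ a * c + (a * b + e + g)
    lemma = solve-∀

  -- The point x is an arbitrary stopover: stopping there can only add cost, so tours with matching
  -- endpoints can be chained.
  travel-++ : ∀ p x ρ₁ ρ₂ k q → travel p (ρ₁ ++ ρ₂) k q ≤ travel p ρ₁ k x + travel x ρ₂ (k ∸ weight ρ₁) q
  travel-++ p x [] ρ₂ k q = travel-via p x ρ₂ k q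
  travel-++ p x (f ∷ ρ₁) ρ₂ k q = begin
    c + travel (r f) (ρ₁ ++ ρ₂) k₁ q
      ≤⟨ +-monoʳ-≤ c (travel-++ (r f) x ρ₁ ρ₂ k₁ q) ⟩
    c + (travel (r f) ρ₁ k₁ x + travel x ρ₂ (k₁ ∸ weight ρ₁) q)             ≡⟨ sym (+-assoc c _ _) ⟩
    c + travel (r f) ρ₁ k₁ x + travel x ρ₂ (k₁ ∸ weight ρ₁) q
      ≡⟨ cong (λ y → c + travel (r f) ρ₁ k₁ x + travel x ρ₂ y q) (∸-+-assoc k (w f) (weight ρ₁)) ⟩
    travel p (f ∷ ρ₁) k x + travel x ρ₂ (k ∸ weight (f ∷ ρ₁)) q             ∎
    where
    open ≤-Reasoning
    k₁ c : ℕ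
    k₁ = k ∸ w f
    c  = k * ∣ ℓ f - p ∣ + k₁ * s f

  -- The endpoints are part of the specification so that costs of consecutive parts add up: ℜ goes
  -- from `r j` to `ℓ i`, and 𝔉 from `r j` back to `r j`.
  Schedule : ℕ → ℕ → ℕ → ℕ → ℕ → ℕ → Set
  Schedule i j k p q c = ∃[ ρ ] ρ ↭ range i (suc j) × travel p ρ k q ≤ c

  weight-range : ∀ {ρ i j} → ρ ↭ range i (suc j) → weight ρ ≡ W i (suc j)
  weight-range ρ↭ = sum-↭ (map⁺ w ρ↭)

  schedule-return : ∀ {i j k p q c} x → Schedule i j k p q c → Schedule i j k p x (c + k′ k i j * ∣ x - q ∣)
  schedule-return {i} {j} {k} {p} {q} {c} x (ρ , ρ↭ , h) = ρ , ρ↭ , (begin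
    travel p ρ k x
      ≡⟨ cong (λ ρ → travel p ρ k x) (sym (++-identityʳ ρ)) ⟩
    travel p (ρ ++ []) k x                        ≤⟨ travel-++ p q ρ [] k x ⟩
    travel p ρ k q + (k ∸ weight ρ) * ∣ x - q ∣
      ≤⟨ +-mono-≤ h (≤-reflexive (cong (λ y → (k ∸ y) * ∣ x - q ∣) (weight-range {ρ} {i} {j} ρ↭))) ⟩
    c + k′ k i j * ∣ x - q ∣                       ∎)
    where open ≤-Reasoning

  schedule-++ : ∀ {i j h k p x q c₁ c₂} → i ≤ suc h → h ≤ j →
                Schedule (suc h) j k p x c₁ → Schedule i h (k′ k (suc h) j) x q c₂ →
                Schedule i j k p q (c₁ + c₂)
  schedule-++ {i} {j} {h} {k} {p} {x} {q} {c₁} {c₂} i≤ h≤j (ρ₁ , ρ₁↭ , le₁) (ρ₂ , ρ₂↭ , le₂) =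
    ρ₁ ++ ρ₂ ,
    ↭-trans (++⁺ ρ₁↭ ρ₂↭) (↭-trans (++-comm (range (suc h) (suc j)) (range i (suc h)))
      (↭-reflexive (sym (range-++ i≤ (s≤s h≤j))))) ,
    (begin
    travel p (ρ₁ ++ ρ₂) k q                              ≤⟨ travel-++ p x ρ₁ ρ₂ k q ⟩
    travel p ρ₁ k x + travel x ρ₂ (k ∸ weight ρ₁) q
      ≡⟨ cong (λ y → travel p ρ₁ k x + travel x ρ₂ (k ∸ y) q) (weight-range {ρ₁} {suc h} {j} ρ₁↭) ⟩
    travel p ρ₁ k x + travel x ρ₂ (k′ k (suc h) j) q     ≤⟨ +-mono-≤ le₁ le₂ ⟩
    c₁ + c₂                                              ∎)
    where open ≤-Reasoning

  schedule-∷ʳ : ∀ {i b k p q c} → i ≤ suc b → Schedule i b k p q c →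
                Schedule i (suc b) k p (r (suc b)) (c + (k′ k i b * ∣ ℓ (suc b) - q ∣ + k′ k i (suc b) * s (suc b)))
  schedule-∷ʳ {i} {b} {k} {p} {q} {c} i≤ (ρ , ρ↭ , le) =
    ρ ∷ʳ j , ↭-trans (++⁺ʳ [ j ] ρ↭) (↭-reflexive (sym (range-∷ʳ i≤))) , (begin
    travel p (ρ ++ [ j ]) k (r j)                          ≤⟨ travel-++ p q ρ [ j ] k (r j) ⟩
    travel p ρ k q + travel q [ j ] (k ∸ weight ρ) (r j)
      ≡⟨ cong (λ y → travel p ρ k q + travel q [ j ] (k ∸ y) (r j)) (weight-range {ρ} {i} {b} ρ↭) ⟩
    travel p ρ k q + travel q [ j ] (k′ k i b) (r j)       ≤⟨ +-monoˡ-≤ _ le ⟩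
    c + (k′ k i b * D + (k′ k i b ∸ w j) * s j + (k′ k i b ∸ w j) * ∣ r j - r j ∣)
      ≡⟨ cong₂ (λ y z → c + (k′ k i b * D + y * s j + y * z)) k′-suc (∣n-n∣≡0 (r j)) ⟩
    c + (k′ k i b * D + k′ k i j * s j + k′ k i j * 0)
      ≡⟨ lemma c (k′ k i b * D) (k′ k i j * s j) (k′ k i j) ⟩
    c + (k′ k i b * D + k′ k i j * s j)                    ∎)
    where
    open ≤-Reasoning
    j D : ℕ
    j = suc b
    D = ∣ ℓ (suc b) - q ∣
    k′-suc : k′ k i b ∸ w j ≡ k′ k i j
    k′-suc = trans (∸-+-assoc k (W i j) (w j)) (cong (k ∸_) (sym (Σ-suc w {i} {j} i≤)))
    lemma : ∀ a b c e → a + (b + c + e * 0) ≡ a + (b + c)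
    lemma = solve-∀

  ∣ℓ-r∣ : ∀ i → ∣ ℓ i - r i ∣ ≡ s i
  ∣ℓ-r∣ i = ∣m-m+n∣≡n (ℓ i) (s i)

  -- The tour behind 𝔉: pass over the last file without reading it, read h + 1, ..., b, then the
  -- files of the inner 𝔉, which ends at `r h`, and come back for the last file.
  schedule-last : ∀ {i b h k c₁ c₂} → i ≤ h → h < suc b →
                  Schedule (suc h) b k (r b) (ℓ (suc h)) c₁ →
                  Schedule i h (k′ k (suc h) b) (r h) (r h) c₂ →
                  Schedule i (suc b) k (r (suc b)) (r (suc b))
                    (k * s (suc b) + (c₁ + c₂ + k′ k i b * d h (suc b)) + k′ k i (suc b) * s (suc b))
  schedule-last {i} {b} {h} {k} {c₁} {c₂} i≤h h<j S₁ S₂ with schedule-∷ʳ (m≤n⇒m≤1+n (≤-trans i≤h (s≤s⁻¹ h<j)))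
    (schedule-++ (m≤n⇒m≤1+n i≤h) (s≤s⁻¹ h<j) S₁ (subst (λ x → Schedule i h (k′ k (suc h) b) x (r h) c₂) (sym (ℓ-suc h)) S₂))
  ... | ρ , ρ↭ , le = ρ , ρ↭ , (begin
    travel (r j) ρ k (r j)
      ≤⟨ travel-via (r j) (r b) ρ k (r j) ⟩
    k * ∣ r b - r j ∣ + travel (r b) ρ k (r j)
      ≤⟨ +-mono-≤ (≤-reflexive (cong (k *_) skip-j)) le ⟩
    k * s j + (c₁ + c₂ + (k′ k i b * d h j + k′ k i j * s j))
      ≡⟨ lemma (k * s j) (c₁ + c₂) (k′ k i b * d h j) (k′ k i j * s j) ⟩
    k * s j + (c₁ + c₂ + k′ k i b * d h j) + k′ k i j * s j        ∎)
    where
    open ≤-Reasoning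
    j : ℕ
    j = suc b
    skip-j : ∣ r b - r j ∣ ≡ s j
    skip-j = trans (cong (λ x → ∣ x - r j ∣) (sym (ℓ-suc b))) (∣ℓ-r∣ j)
    lemma : ∀ a b c e → a + (b + (c + e)) ≡ a + (b + c) + e
    lemma = solve-∀

  mutual
    ℜ-schedule : ∀ e {i j} k → j ∸ i < e → i ≤ suc j → Schedule i j k (r j) (ℓ i) (ℜ i j k)
    ℜ-schedule (suc e) {i} {j} k dep i≤1+j with m≤n⇒m<n∨m≡n i≤1+j
    ... | inj₂ refl = [] , ↭-reflexive (sym (range-empty {suc j} ≤-refl)) , ≤-trans (≤-reflexive
          (trans (cong (k *_) (m≡n⇒∣m-n∣≡0 (ℓ-suc j))) (*-zeroʳ k))) z≤n
    ... | inj₁ i<1+j with ℜ-cases k (s≤s⁻¹ i<1+j)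
    ... | inj₁ eq = subst (Schedule i j k (r j) (ℓ i)) (sym eq)
          (schedule-return (ℓ i) (𝔉-schedule (suc e) k dep (s≤s⁻¹ i<1+j)))
    ... | inj₂ (suc h , s≤s i≤h , h<j , eq) = subst (Schedule i j k (r j) (ℓ i)) (sym eq)
          (schedule-++ (m≤n⇒m≤1+n i≤h) (<⇒≤ h<j)
            (ℜ-schedule e k (<-≤-trans (∸-monoʳ-< (s≤s i≤h) h<j) (s≤s⁻¹ dep)) (m≤n⇒m≤1+n h<j))
            (subst (λ x → Schedule i h (k′ k (suc h) j) x (ℓ i) (ℜ i h (k′ k (suc h) j))) (sym (ℓ-suc h))
              (ℜ-schedule e _ (<-≤-trans (∸-monoˡ-< h<j i≤h) (s≤s⁻¹ dep)) (m≤n⇒m≤1+n i≤h))))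

    𝔉-schedule : ∀ e {i j} k → j ∸ i < e → i ≤ j → Schedule i j k (r j) (r j) (𝔉 i j k)
    𝔉-schedule (suc e) {i} {j} k dep i≤j with m≤n⇒m<n∨m≡n i≤j
    ... | inj₂ refl = [ i ] , ↭-reflexive (sym (trans (range-∷ʳ {i} ≤-refl) (cong (_∷ʳ i) (range-empty {i} ≤-refl)))) ,
          ≤-reflexive (begin
            k * ∣ ℓ i - r i ∣ + (k ∸ w i) * s i + (k ∸ w i) * ∣ r i - r i ∣
              ≡⟨ cong₂ (λ x y → k * x + (k ∸ w i) * s i + (k ∸ w i) * y) (∣ℓ-r∣ i) (∣n-n∣≡0 (r i)) ⟩
            k * s i + (k ∸ w i) * s i + (k ∸ w i) * 0
              ≡⟨ lemma (k * s i) ((k ∸ w i) * s i) (k ∸ w i) ⟩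
            k * s i + (k ∸ w i) * s i
              ≡⟨ cong (λ x → k * s i + (k ∸ x) * s i) (sym (W-single i)) ⟩
            k * s i + k′ k i i * s i                                         ≡⟨ sym (𝔉-base i k) ⟩
            𝔉 i i k                                                          ∎)
      where
      open ≡-Reasoning
      lemma : ∀ a b c → a + b + c * 0 ≡ a + b
      lemma = solve-∀
    𝔉-schedule (suc e) {i} {suc b} k dep _ | inj₁ i<j with 𝔉-cases k i<j
    ... | h , i≤h , h<j , eq = subst (Schedule i (suc b) k _ _) (sym eq) (schedule-last i≤h h<j
          (ℜ-schedule e k (≤-<-trans (∸-monoˡ-≤ (suc h) (n≤1+n b))
            (<-≤-trans (∸-monoʳ-< (s≤s i≤h) h<j) (s≤s⁻¹ dep))) h<j)
          (𝔉-schedule e _ (<-≤-trans (∸-monoˡ-< h<j i≤h) (s≤s⁻¹ dep)) i≤h))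

  optimal-schedule : Schedule 0 last m (r last) 0 (ℜ 0 last m)
  optimal-schedule = ℜ-schedule (suc last) m ≤-refl z≤n

  -- The cost of a permutation as pending requests summed over time.

  arrival : ∀ {N} → ℕ → (Fin N → ℕ) → Fin N → ℕ
  arrival p g zero    = ∣ ℓ (g zero) - p ∣
  arrival p g (suc t) = ∣ ℓ (g zero) - p ∣ + s (g zero) + arrival (r (g zero)) (g ∘ suc) t

  -- Each leg after the first begins with the reading of the previous file; the offset c carries
  -- that reading time into the recursive step.
  prefixSum≡arrival : ∀ {N} (e g : Fin (suc N) → ℕ) {c p} → e zero ≡ c + ∣ ℓ (g zero) - p ∣ →
                      (∀ t → e (suc t) ≡ s (g (inject₁ t)) + d (g (inject₁ t)) (g (suc t))) →
                      ∀ t → prefixSum e t ≡ c + arrival p g t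
  prefixSum≡arrival e g e₀ eₛ zero = e₀
  prefixSum≡arrival {suc N} e g {c} {p} e₀ eₛ (suc t) = begin
    e zero + prefixSum (e ∘ suc) t
      ≡⟨ cong₂ _+_ e₀ (prefixSum≡arrival (e ∘ suc) (g ∘ suc) (eₛ zero) (eₛ ∘ suc) t) ⟩
    c + D + (s (g zero) + A)                        ≡⟨ lemma c D (s (g zero)) A ⟩
    c + (D + s (g zero) + A)                        ∎
    where
    open ≡-Reasoning
    D A : ℕ
    D = ∣ ℓ (g zero) - p ∣
    A = arrival (r (g zero)) (g ∘ suc) t
    lemma : ∀ a b c e → a + b + (c + e) ≡ a + (b + c + e)
    lemma = solve-∀

  response≡arrival : ∀ π t → response π t ≡ arrival L (file π) t
  response≡arrival π = prefixSum≡arrival (leg π) (file π) {0} refl λ _ → refl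

  ∑-weighted-+ : ∀ {N} (g : Fin N → ℕ) c (x : Fin N → ℕ) →
                 ∑[ t < N ] (w (g t) * (c + x t)) ≡ c * weight (tabulate g) + ∑[ t < N ] (w (g t) * x t)
  ∑-weighted-+ {zero}  g c x = sym (trans (+-identityʳ _) (*-zeroʳ c))
  ∑-weighted-+ {suc N} g c x = trans
    (cong (w (g zero) * (c + x zero) +_) (∑-weighted-+ (g ∘ suc) c (x ∘ suc)))
    (lemma (w (g zero)) c (x zero) (weight (tabulate (g ∘ suc))) _)
    where
    lemma : ∀ a b e f h → a * (b + e) + (b * f + h) ≡ b * (a + f) + (a * e + h)
    lemma = solve-∀

  -- Exchange of summation, one file at a time: `∑-weighted-+` charges the delay caused by the first
  -- file to every request after it. At the end nothing is pending, so the final position q is free.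
  travel-tabulate : ∀ {N} p (g : Fin N → ℕ) q →
                    travel p (tabulate g) (weight (tabulate g)) q ≡ ∑[ t < N ] (w (g t) * arrival p g t)
  travel-tabulate {zero}  p g q = refl
  travel-tabulate {suc N} p g q = begin
    (w₀ + K) * D + (w₀ + K ∸ w₀) * s₀ + travel (r (g zero)) ρ (w₀ + K ∸ w₀) q
      ≡⟨ cong (λ k → (w₀ + K) * D + k * s₀ + travel (r (g zero)) ρ k q) (m+n∸m≡n w₀ K) ⟩
    (w₀ + K) * D + K * s₀ + travel (r (g zero)) ρ K q
      ≡⟨ cong ((w₀ + K) * D + K * s₀ +_) (travel-tabulate (r (g zero)) (g ∘ suc) q) ⟩
    (w₀ + K) * D + K * s₀ + V
      ≡⟨ lemma w₀ K D s₀ V ⟩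
    w₀ * D + ((D + s₀) * K + V)
      ≡⟨ cong (w₀ * D +_) (sym (∑-weighted-+ (g ∘ suc) (D + s₀) (arrival (r (g zero)) (g ∘ suc)))) ⟩
    ∑[ t < suc N ] (w (g t) * arrival p g t) ∎
    where
    open ≡-Reasoning
    w₀ s₀ D K V : ℕ
    w₀ = w (g zero)
    s₀ = s (g zero)
    D  = ∣ ℓ (g zero) - p ∣
    ρ : List ℕ
    ρ = tabulate (g ∘ suc)
    K  = weight ρ
    V = ∑[ t < N ] (w (g (suc t)) * arrival (r (g zero)) (g ∘ suc) t)
    lemma : ∀ a b c e f → (a + b) * c + b * e + f ≡ a * c + ((c + e) * b + f)
    lemma = solve-∀

  weight-tabulate : ∀ {N} (g : Fin N → ℕ) → weight (tabulate g) ≡ ∑[ t < N ] w (g t)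
  weight-tabulate {zero}  g = refl
  weight-tabulate {suc N} g = cong (w (g zero) +_) (weight-tabulate (g ∘ suc))

  w-toℕ : ∀ i → w (toℕ i) ≡ req i
  w-toℕ = extend-toℕ req
    where
    extend-toℕ : ∀ {N} (f : Fin N → ℕ) i → extend f (toℕ i) ≡ f i
    extend-toℕ f zero    = refl
    extend-toℕ f (suc i) = extend-toℕ (f ∘ suc) i

  weight-file : ∀ π → weight (tabulate (file π)) ≡ m
  weight-file π = begin
    weight (tabulate (file π))     ≡⟨ weight-tabulate (file π) ⟩
    ∑[ t < n ] w (file π t)        ≡⟨ sum-cong-≗ {n} (λ t → w-toℕ (π ⟨$⟩ʳ t)) ⟩
    ∑[ t < n ] req (π ⟨$⟩ʳ t)      ≡⟨ sym (∑-permute req π) ⟩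
    m                              ∎
    where open ≡-Reasoning

  cost≡travel : ∀ π q → cost π ≡ travel L (tabulate (file π)) m q
  cost≡travel π q = begin
    cost π
      ≡⟨ sum-cong-≗ {n} (λ t → cong (w (file π t) *_) (response≡arrival π t)) ⟩
    ∑[ t < n ] (w (file π t) * arrival L (file π) t)        ≡⟨ sym (travel-tabulate L (file π) q) ⟩
    travel L (tabulate (file π)) (weight (tabulate (file π))) q
      ≡⟨ cong (λ k → travel L (tabulate (file π)) k q) (weight-file π) ⟩
    travel L (tabulate (file π)) m q                        ∎
    where open ≡-Reasoning

  tabulate-lookup-cast : ∀ {N} (xs : List ℕ) (eq : N ≡ length xs) → tabulate (lookup xs ∘ cast eq) ≡ xs
  tabulate-lookup-cast xs refl =
    trans (tabulate-cong (λ i → cong (lookup xs) (cast-is-id refl i))) (tabulate-lookup xs)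

  -- The bijection of positions underlying the list permutation is itself the reading order, because
  -- entry i of `range 0 n` is i.
  ↭range⇒file : ∀ {ρ} → ρ ↭ range 0 n → ∃[ π ] tabulate (file π) ≡ ρ
  ↭range⇒file {ρ} ρ↭ = π , trans (tabulate-cong file≗) (tabulate-lookup-cast ρ len)
    where
    open ≡-Reasoning
    len-range : length (range 0 n) ≡ n
    len-range = length-applyUpTo id n
    len : n ≡ length ρ
    len = sym (trans (↭-length ρ↭) len-range)
    ρ↭ₛ = ↭⇒↭ₛ ρ↭
    π : Permutation′ n
    π = cast-id len ∘ₚ (onIndices ρ↭ₛ ∘ₚ cast-id len-range)
    file≗ : ∀ t → file π t ≡ lookup ρ (cast len t)
    file≗ t = begin
      toℕ (cast len-range i)        ≡⟨ toℕ-cast len-range i ⟩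
      toℕ i                         ≡⟨ sym (lookup-applyUpTo id n i) ⟩
      lookup (range 0 n) i          ≡⟨ sym (onIndices-lookup (setoid ℕ) ρ↭ₛ (cast len t)) ⟩
      lookup ρ (cast len t)         ∎
      where
      i = onIndices ρ↭ₛ ⟨$⟩ʳ cast len t

  pending-all : pending [] n ≡ m
  pending-all = trans (+-identityʳ (W 0 n)) W-all

  ℜ-optimal : IsOptimalValue (ℜ 0 last m)
  ℜ-optimal = attained , bound
    where
    bound : ∀ π → ℜ 0 last m ≤ cost π
    bound π = subst₂ _≤_ (cong (ℜ 0 last) pending-all)
      (trans (cong (λ k → travel L (tabulate (file π)) k 0) (weight-file π)) (sym (cost≡travel π 0)))
      (lower-bound 0 (All.tabulate⁺ (λ t → toℕ<n (π ⟨$⟩ʳ t))) every)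
      where
      every : ∀ {x} → x < n → x ∈ tabulate (file π)
      every {x} x<n = subst (_∈ tabulate (file π)) (trans (cong toℕ (inverseʳ π)) (toℕ-fromℕ< x<n))
        (∈-tabulate⁺ {f = file π} (π ⟨$⟩ˡ fromℕ< x<n))
    attained : ∃ λ π → cost π ≡ ℜ 0 last m
    attained with optimal-schedule
    ... | ρ , ρ↭ , le with ↭range⇒file ρ↭
    ... | π , refl = π , ≤-antisym (≤-trans (≤-reflexive (cost≡travel π 0)) le) (bound π)

-- Running minima, memory updates and program rules.

min-∷ : ∀ a x xs → min a (x ∷ xs) ≡ a ⊓ min x xs
min-∷ a x xs = ≤-antisym
  (⊓-glb (min≤⊤ a (x ∷ xs)) (v≤min⁺ (All.head ≤xs) (All.tail ≤xs)))
  (v≤min⁺ (m⊓n≤m a _) (≤-trans (m⊓n≤n a _) (min≤⊤ x xs) ∷ All.map (≤-trans (m⊓n≤n a _)) (min≤xs x xs)))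
  where
  ≤xs = min≤xs a (x ∷ xs)

min-∷ʳ : ∀ a xs x → min a (xs ∷ʳ x) ≡ min a xs ⊓ x
min-∷ʳ a xs x with ∷ʳ⁻ (min≤xs a (xs ∷ʳ x))
... | ≤xs , ≤x = ≤-antisym
  (⊓-glb (v≤min⁺ (min≤⊤ a (xs ∷ʳ x)) ≤xs) ≤x)
  (v≤min⁺ (≤-trans (m⊓n≤m _ x) (min≤⊤ a xs)) (∷ʳ⁺ (All.map (≤-trans (m⊓n≤m _ x)) (min≤xs a xs)) (m⊓n≤n _ x)))

minimum-applyUpTo : ∀ g b → minimum (applyUpTo g (suc (suc b))) ≡ minimum (applyUpTo g (suc b)) ⊓ g (suc b)
minimum-applyUpTo g b = trans (cong (min (g 0)) (sym (applyUpTo-∷ʳ (g ∘ suc) b))) (min-∷ʳ (g 0) (applyUpTo (g ∘ suc) b) (g (suc b)))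

update-≡ : ∀ {A : Set} (f : ℕ → A) x v → (f [ x ↦ v ]) x ≡ v
update-≡ f x v with x ≡ᵇ x | ≡⇒≡ᵇ x x refl
... | true | _ = refl

update-≢ : ∀ {A : Set} (f : ℕ → A) {x y} v → x ≢ y → (f [ x ↦ v ]) y ≡ f y
update-≢ f {x} {y} v x≢y with x ≡ᵇ y | ≡ᵇ⇒≡ x y
... | true  | eq = contradiction (eq tt) x≢y
... | false | _  = refl

-- A Hoare triple for one fixed initial state, together with a time bound.
record Run (P : Program) (σ : State) (t : ℕ) (Q : State → Set) : Set where
  constructor run
  field
    post    : Q (proj₁ (exec P σ))
    elapsed : proj₂ (exec P σ) ≤ t

open Run

run-map : ∀ {P σ t t′} {Q Q′ : State → Set} → t ≤ t′ → (∀ {τ} → Q τ → Q′ τ) → Run P σ t Q → Run P σ t′ Q′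
run-map t≤ f (run q e) = run (f q) (≤-trans e t≤)

run-skip : ∀ {σ} {Q : State → Set} → Q σ → Run skip σ 1 Q
run-skip q = run q ≤-refl

run-≔ : ∀ {x e σ} {Q : State → Set} → Q (setReg x (eval e σ) σ) → Run (x ≔ e) σ (suc (time e)) Q
run-≔ q = run q ≤-refl

run-store : ∀ {a e e′ σ} {Q : State → Set} → Q (setArray a (eval e σ) (eval e′ σ) σ) →
            Run (store a e e′) σ (suc (time e + time e′)) Q
run-store q = run q ≤-refl

run-⨟ : ∀ {P P′ σ t t′} {Q R : State → Set} → Run P σ t Q → (∀ {τ} → Q τ → Run P′ τ t′ R) →
        Run (P ⨟ P′) σ (t + t′) R
run-⨟ (run q e) f = run (post (f q)) (+-mono-≤ e (elapsed (f q)))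

-- Adding the times of both branches gives a bound that does not depend on the test.
run-if : ∀ {e e′ P P′ σ t t′} {Q : State → Set} →
         (eval e σ ≤ eval e′ σ → Run P σ t Q) → (eval e′ σ < eval e σ → Run P′ σ t′ Q) →
         Run (if≤ e e′ P P′) σ (suc (time e + time e′ + (t + t′))) Q
run-if {e} {e′} {P} {P′} {σ} {t} {t′} {Q} yes-run no-run =
  run (proj₁ taken) (s≤s (+-monoʳ-≤ (time e + time e′) (proj₂ taken)))
  where
  branch : ∀ b → (T b → Run P σ t Q) → (¬ T b → Run P′ σ t′ Q) →
           let σ₁ , t₁ = if b then exec P σ else exec P′ σ in Q σ₁ × t₁ ≤ t + t′
  branch true  f _ = post (f tt) , ≤-trans (elapsed (f tt)) (m≤m+n t t′)
  branch false _ f = post (f id) , ≤-trans (elapsed (f id)) (m≤n+m t′ t)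
  taken = branch (eval e σ ≤ᵇ eval e′ σ) (yes-run ∘ ≤ᵇ⇒≤ _ _) (λ ≰ → no-run (≰⇒> (≰ ∘ ≤⇒≤ᵇ)))

run-for : ∀ {x e P σ t b} (Q : ℕ → State → Set) → eval e σ ≡ b → Q 0 σ →
          (∀ {i τ} → i < b → Q i τ → Run P (setReg x i τ) t (Q (suc i))) →
          Run (for x e P) σ (suc (time e + b * suc t)) (Q b)
run-for {x} {e} {P} {σ} {t} Q refl q₀ step = run (proj₁ (loop (eval e σ) ≤-refl)) (s≤s (+-monoʳ-≤ (time e) (proj₂ (loop (eval e σ) ≤-refl))))
  where
  body : ℕ → State → State × ℕ
  body i τ = exec P (setReg x i τ)
  loop : ∀ i → i ≤ eval e σ → Q i (proj₁ (iterate body i σ)) × proj₂ (iterate body i σ) ≤ i * suc t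
  loop zero    _  = q₀ , z≤n
  loop (suc i) i< with loop i (<⇒≤ i<)
  ... | q , el with step i< q
  ... | run q′ el′ = q′ , ≤-trans (+-mono-≤ el (s≤s el′)) (≤-reflexive (+-comm (i * suc t) (suc t)))

-- Registers: 0 n, 1 loops of the set-up and the rows, 2 i, 3 j, 4 k, 5 running minimum,
-- 6 offset x (j′ = i + x for 𝔉, j′ = i + x + 1 for ℜ), 7 n + 1, 8 𝔉 i j k.
-- Arrays: 2 the sums of w over initial segments, 3 ℓ, 4 ℜ, 5 𝔉.
index : Expr → Expr → Expr → Expr
index a b c = (a ⊗ reg 7 ⊕ b) ⊗ reg 7 ⊕ c

ℜ-at 𝔉-at k′-at : Expr → Expr → Expr → Expr
ℜ-at a b c  = load 4 (index a b c)
𝔉-at a b c  = load 5 (index a b c)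
k′-at c a b = c ⊖ (load 2 (lit 1 ⊕ b) ⊖ load 2 a)

r-at : Expr → Expr
r-at a = load 3 a ⊕ load 0 a

d-at : Expr → Expr → Expr
d-at a b = (load 3 b ⊖ r-at a) ⊕ (r-at a ⊖ load 3 b)

mid : Expr
mid = reg 2 ⊕ reg 6

𝔉-candidate ℜ-candidate : Expr
𝔉-candidate = ℜ-at (lit 1 ⊕ mid) (reg 3 ⊖ lit 1) (reg 4)
              ⊕ 𝔉-at (reg 2) mid (k′-at (reg 4) (lit 1 ⊕ mid) (reg 3 ⊖ lit 1))
              ⊕ k′-at (reg 4) (reg 2) (reg 3 ⊖ lit 1) ⊗ d-at mid (reg 3)
ℜ-candidate = ℜ-at (lit 1 ⊕ mid) (reg 3) (reg 4)
              ⊕ ℜ-at (reg 2) mid (k′-at (reg 4) (lit 1 ⊕ mid) (reg 3))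

-- The first candidate is stored outright, so no value has to stand for infinity. Without candidates
-- register 5 keeps 0, which is `minimum []`.
improve minimize : Expr → Program
improve e  = if≤ (reg 6) (lit 0) (5 ≔ e) (if≤ e (reg 5) (5 ≔ e) skip)
minimize e = 5 ≔ lit 0 ⨟ for 6 (reg 3 ⊖ reg 2) (improve e)

compute-𝔉 compute-ℜ : Expr
compute-𝔉 = reg 4 ⊗ load 0 (reg 3) ⊕ reg 5 ⊕ k′-at (reg 4) (reg 2) (reg 3) ⊗ load 0 (reg 3)
compute-ℜ = reg 8 ⊕ k′-at (reg 4) (reg 2) (reg 3) ⊗ d-at (reg 3) (reg 2)

single : Expr
single = reg 4 ⊗ load 0 (reg 2) ⊕ lit 2 ⊗ (reg 4 ⊖ load 1 (reg 2)) ⊗ load 0 (reg 2)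

-- Each row computes all columns, also those with j < i: 𝔉 looks up ℜ on an empty interval when j′ =
-- j - 1, and that cell holds 0. The loop over k has n + 1 rounds, since k = 0 occurs.
finish-ℜ cell row table add-file setup solve : Program
finish-ℜ = if≤ (reg 3) (reg 2)
  (if≤ (reg 2) (reg 3) (5 ≔ single) (5 ≔ lit 0))
  (8 ≔ compute-ℜ ⨟ if≤ (reg 5) (reg 8) skip (5 ≔ reg 8))
cell = minimize 𝔉-candidate
  ⨟ 8 ≔ compute-𝔉
  ⨟ store 5 (index (reg 2) (reg 3) (reg 4)) (reg 8)
  ⨟ minimize ℜ-candidate
  ⨟ finish-ℜ
  ⨟ store 4 (index (reg 2) (reg 3) (reg 4)) (reg 5)
row = for 3 (reg 0) (for 4 (reg 7) cell)
table = for 1 (reg 0) (2 ≔ reg 0 ⊖ lit 1 ⊖ reg 1 ⨟ row)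
add-file = store 2 (lit 1 ⊕ reg 1) (load 2 (reg 1) ⊕ load 1 (reg 1))
  ⨟ store 3 (lit 1 ⊕ reg 1) (load 3 (reg 1) ⊕ load 0 (reg 1))
setup = 7 ≔ lit 1 ⊕ reg 0 ⨟ for 1 (reg 0) add-file
solve = setup ⨟ table ⨟ 0 ≔ ℜ-at (lit 0) (reg 0 ⊖ lit 1) (load 2 (reg 0))

improve-time : Expr → ℕ
improve-time e = suc (2 + (suc (time e) + suc (time e + 1 + (suc (time e) + 1))))

minimize-time : Expr → ℕ → ℕ
minimize-time e b = 2 + (4 + b * suc (improve-time e))

index-time finish-time : ℕ
index-time  = time (index (reg 2) (reg 3) (reg 4))
finish-time = suc (2 + (suc (2 + (suc (time single) + 2)) + (suc (time compute-ℜ) + suc (2 + (1 + 2)))))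

cell-time : ℕ → ℕ
cell-time b = minimize-time 𝔉-candidate b + (suc (time compute-𝔉) + (suc (index-time + 1)
  + (minimize-time ℜ-candidate b + (finish-time + suc (index-time + 1)))))

column-time row-time table-time setup-time solve-time : ℕ → ℕ
column-time n = 2 + suc n * suc (cell-time n)
row-time n    = 2 + n * suc (column-time n)
table-time n  = 2 + n * suc (6 + row-time n)
setup-time n  = 4 + (2 + n * 19)
solve-time n  = setup-time n + (table-time n + suc (time (ℜ-at (lit 0) (reg 0 ⊖ lit 1) (load 2 (reg 0)))))

-- Replaces the number j - i of candidates by n, uniformly for all cells.
cell-time-mono : ∀ {b c} → b ≤ c → cell-time b ≤ cell-time c
cell-time-mono {b} {c} b≤c = +-mono-≤ (minimize-mono 𝔉-candidate) (+-monoʳ-≤ (suc (time compute-𝔉)) (+-monoʳ-≤ (suc (index-time + 1))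
  (+-monoˡ-≤ (finish-time + suc (index-time + 1)) (minimize-mono ℜ-candidate))))
  where
  minimize-mono : ∀ e → minimize-time e b ≤ minimize-time e c
  minimize-mono e = +-monoʳ-≤ 6 (*-monoˡ-≤ (suc (improve-time e)) b≤c)

-- The exceptions are the two scratch registers of `minimize`. Boolean equations let `refl` settle
-- the side conditions for numerals.
Same : State → State → Set
Same σ τ = arrays τ ≡ arrays σ × (∀ y → (5 ≡ᵇ y) ≡ false → (6 ≡ᵇ y) ≡ false → regs τ y ≡ regs σ y)

run-minimize : ∀ {e σ b} (g : ℕ → ℕ) → regs σ 3 ∸ regs σ 2 ≡ b →
               (∀ {x τ} → x < b → Same σ τ → regs τ 6 ≡ x → eval e τ ≡ g x) →
               Run (minimize e) σ (minimize-time e b)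
                 (λ τ → Same σ τ × regs τ 5 ≡ minimum (applyUpTo g b))
run-minimize {e} {σ} {b} g refl e≡ = run-⨟ (run-≔ {Q = _≡ setReg 5 0 σ} refl)
  λ { refl → run-for Inv refl ((refl , λ { y p _ → kept y p }) , refl) step }
  where
  Inv : ℕ → State → Set
  Inv x τ = Same σ τ × regs τ 5 ≡ minimum (applyUpTo g x)
  kept : ∀ y → (5 ≡ᵇ y) ≡ false → regs (setReg 5 0 σ) y ≡ regs σ y
  kept y p rewrite p = refl
  same-6 : ∀ {τ x} → Same σ τ → Same σ (setReg 6 x τ)
  same-6 {τ} {x} (p , q) = p , λ y y≢5 y≢6 → trans (regs-6 y y≢6) (q y y≢5 y≢6)
    where
    regs-6 : ∀ y → (6 ≡ᵇ y) ≡ false → regs (setReg 6 x τ) y ≡ regs τ y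
    regs-6 y p rewrite p = refl
  same-5 : ∀ {τ v} → Same σ τ → Same σ (setReg 5 v τ)
  same-5 {τ} {v} (p , q) = p , λ y y≢5 y≢6 → trans (regs-5 y y≢5) (q y y≢5 y≢6)
    where
    regs-5 : ∀ y → (5 ≡ᵇ y) ≡ false → regs (setReg 5 v τ) y ≡ regs τ y
    regs-5 y p rewrite p = refl
  step : ∀ {x τ} → x < b → Inv x τ → Run (improve e) (setReg 6 x τ) (improve-time e) (Inv (suc x))
  step {zero} {τ} x<b (same , best) = run-if
    (λ _ → run-≔ (same-5 (same-6 same) , e≡ x<b (same-6 same) refl))
    (λ ())
  step {suc x} {τ} x<b (same , best) = run-if {t = suc (time e)}
    (λ ())
    (λ _ → run-if
      (λ e≤ → run-≔ (same-5 (same-6 same) , (begin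
        eval e τ′                                 ≡⟨ sym (m≥n⇒m⊓n≡n e≤) ⟩
        regs τ 5 ⊓ eval e τ′                      ≡⟨ cong₂ _⊓_ best (e≡ x<b (same-6 same) refl) ⟩
        minimum (applyUpTo g (suc x)) ⊓ g (suc x) ≡⟨ sym (minimum-applyUpTo g x) ⟩
        minimum (applyUpTo g (suc (suc x)))       ∎)))
      (λ e> → run-skip (same-6 same , (begin
        regs τ 5                                  ≡⟨ sym (m≤n⇒m⊓n≡m (<⇒≤ e>)) ⟩
        regs τ 5 ⊓ eval e τ′                      ≡⟨ cong₂ _⊓_ best (e≡ x<b (same-6 same) refl) ⟩
        minimum (applyUpTo g (suc x)) ⊓ g (suc x) ≡⟨ sym (minimum-applyUpTo g x) ⟩
        minimum (applyUpTo g (suc (suc x)))       ∎))))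
    where
    open ≡-Reasoning
    τ′ : State
    τ′ = setReg 6 (suc x) τ

digits-injective : ∀ N .{{_ : NonZero N}} {a a′ b b′} → b < N → b′ < N → a * N + b ≡ a′ * N + b′ → a ≡ a′ × b ≡ b′
digits-injective N {a} {a′} {b} {b′} b<N b′<N eq = *-cancelʳ-≡ a a′ N (+-cancelʳ-≡ b _ _ (trans eq (cong (a′ * N +_) (sym b≡b′)))) , b≡b′
  where
  open ≡-Reasoning
  low : ∀ a {b} → b < N → (a * N + b) % N ≡ b
  low a {b} b<N = begin
    (a * N + b) % N  ≡⟨ cong (_% N) (+-comm (a * N) b) ⟩
    (b + a * N) % N  ≡⟨ [m+kn]%n≡m%n b a N ⟩
    b % N            ≡⟨ m<n⇒m%n≡m b<N ⟩
    b                ∎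
  b≡b′ : b ≡ b′
  b≡b′ = trans (sym (low a b<N)) (trans (cong (_% N) eq) (low a′ b′<N))

[m∸n]+[n∸m] : ∀ m n → (m ∸ n) + (n ∸ m) ≡ ∣ m - n ∣
[m∸n]+[n∸m] m n with ≤-total m n
... | inj₁ m≤n rewrite m≤n⇒m∸n≡0 m≤n = sym (m≤n⇒∣m-n∣≡n∸m m≤n)
... | inj₂ n≤m rewrite m≤n⇒m∸n≡0 n≤m = trans (+-identityʳ (m ∸ n)) (sym (m≤n⇒∣n-m∣≡n∸m n≤m))

-- Correctness of the table.

module Correctness (I : LTS) where
  open Recursion I public

  Prefix : (ℕ → ℕ) → ℕ → (ℕ → ℕ) → Set
  Prefix g b a = ∀ {y} → y ≤ b → a y ≡ Σ[ g ] 0 y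

  -- Parametrised by memory cells rather than by a state, so that updates elsewhere in memory
  -- preserve it by computation.
  record Inputs (b n′ N : ℕ) (a₀ a₁ a₂ a₃ : ℕ → ℕ) : Set where
    field
      n≡       : n′ ≡ n
      N≡       : N ≡ suc n
      sizes    : ∀ y → a₀ y ≡ s y
      requests : ∀ y → a₁ y ≡ w y
      requests-before : Prefix w b a₂
      lefts    : Prefix s b a₃

  open Inputs

  InputsUpTo : ℕ → State → Set
  InputsUpTo b σ = Inputs b (regs σ 0) (regs σ 7) (arrays σ 0) (arrays σ 1) (arrays σ 2) (arrays σ 3)

  prefix-store : ∀ {g b a v} → Prefix g b a → v ≡ a b + g b → Prefix g (suc b) (a [ suc b ↦ v ])
  prefix-store {g} {b} {a} {v} pre v≡ {y} y≤ with m≤n⇒m<n∨m≡n y≤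
  ... | inj₂ refl = trans (update-≡ a (suc b) v) (trans v≡ (trans (cong (_+ g b) (pre ≤-refl)) (sym (Σ-suc g {0} {b} z≤n))))
  ... | inj₁ y<   = trans (update-≢ a v (<⇒≢ y< ∘ sym)) (pre (s≤s⁻¹ y<))

  address : ℕ → ℕ → ℕ → ℕ
  address x y z = (x * suc n + y) * suc n + z

  address-injective : ∀ {x y z x′ y′ z′} → y < n → z ≤ n → y′ < n → z′ ≤ n →
                      address x y z ≡ address x′ y′ z′ → x ≡ x′ × y ≡ y′ × z ≡ z′
  address-injective y< z≤ y′< z′≤ eq with digits-injective (suc n) (s≤s z≤) (s≤s z′≤) eq
  ... | eq′ , z≡ with digits-injective (suc n) (m<n⇒m<1+n y<) (m<n⇒m<1+n y′<) eq′
  ... | x≡ , y≡ = x≡ , y≡ , z≡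

  Cells : Set₁
  Cells = ℕ → ℕ → ℕ → Set

  Filled : (ℕ → ℕ → ℕ → ℕ) → Cells → (ℕ → ℕ) → Set
  Filled f D a = ∀ {x y z} → x < n → y < n → z ≤ n → D x y z → a (address x y z) ≡ f x y z

  filled-mono : ∀ {f a} {D D′ : Cells} → (∀ {x y z} → x < n → y < n → z ≤ n → D′ x y z → D x y z) →
                Filled f D a → Filled f D′ a
  filled-mono D′⊆D fill x< y< z≤ d′ = fill x< y< z≤ (D′⊆D x< y< z≤ d′)

  -- Rows are filled from the last file downwards, so a larger first index means an earlier cell.
  Before : ℕ → ℕ → ℕ → Cells
  Before i j k x y z = i < x ⊎ (x ≡ i × (y < j ⊎ (y ≡ j × z < k)))

  filled-store : ∀ {f i j k v a} → j < n → k ≤ n → v ≡ f i j k → Filled f (Before i j k) a →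
                 Filled f (Before i j (suc k)) (a [ address i j k ↦ v ])
  filled-store {f} {i} {j} {k} {v} {a} j<n k≤n v≡ fill {x} {y} {z} x< y< z≤ d with address i j k ≟ address x y z
  ... | yes eq with address-injective {i} {j} {k} {x} {y} {z} j<n k≤n y< z≤ eq
  ...   | refl , refl , refl = trans (update-≡ a (address i j k) v) v≡
  filled-store {f} {i} {j} {k} {v} {a} j<n k≤n v≡ fill {x} {y} {z} x< y< z≤ d | no neq =
    trans (update-≢ a v neq) (fill x< y< z≤ (earlier d))
    where
    earlier : Before i j (suc k) x y z → Before i j k x y z
    earlier (inj₁ i<x) = inj₁ i<x
    earlier (inj₂ (x≡ , inj₁ y<j)) = inj₂ (x≡ , inj₁ y<j)
    earlier (inj₂ (x≡ , inj₂ (y≡ , z<1+k))) with m≤n⇒m<n∨m≡n (s≤s⁻¹ z<1+k)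
    ... | inj₁ z<k = inj₂ (x≡ , inj₂ (y≡ , z<k))
    earlier (inj₂ (refl , inj₂ (refl , _))) | inj₂ refl = contradiction refl neq

  -- For b ≤ a truncation agrees with the empty sum; cells with j < i rely on this.
  W-∸ : ∀ a b → W 0 b ∸ W 0 a ≡ W a b
  W-∸ a b with ≤-total a b
  ... | inj₁ a≤b = trans (cong (_∸ W 0 a) (Σ-++ w {0} z≤n a≤b)) (m+n∸m≡n (W 0 a) (W a b))
  ... | inj₂ b≤a = trans (m≤n⇒m∸n≡0 (m+n≤o⇒m≤o (W 0 b) (≤-reflexive (sym (Σ-++ w {0} z≤n b≤a))))) (sym (Σ-empty w b≤a))

  module At {τ : State} (in-τ : InputsUpTo n τ) where

    eval-index : ∀ {a b c x y z} → eval a τ ≡ x → eval b τ ≡ y → eval c τ ≡ z → eval (index a b c) τ ≡ address x y z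
    eval-index refl refl refl rewrite N≡ in-τ = refl

    eval-k′ : ∀ {a b c x y z} → eval c τ ≡ z → eval a τ ≡ x → eval b τ ≡ y → x ≤ n → y < n → eval (k′-at c a b) τ ≡ k′ z x y
    eval-k′ {x = x} {y} {z} refl refl refl x≤ y< = cong (z ∸_)
      (trans (cong₂ _∸_ (requests-before in-τ y<) (requests-before in-τ x≤)) (W-∸ x (suc y)))

    eval-r : ∀ {a x} → eval a τ ≡ x → x < n → eval (r-at a) τ ≡ r x
    eval-r {x = x} refl x< = cong₂ _+_ (lefts in-τ (<⇒≤ x<)) (sizes in-τ x)

    eval-d : ∀ {a b x y} → eval a τ ≡ x → eval b τ ≡ y → x < n → y < n → eval (d-at a b) τ ≡ d x y
    eval-d {a} {b} {x} {y} a≡ refl x< y< = trans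
      (cong₂ (λ l r → (l ∸ r) + (r ∸ l)) (lefts in-τ (<⇒≤ y<)) (eval-r {a} a≡ x<))
      ([m∸n]+[n∸m] (ℓ y) (r x))

    eval-s : ∀ {a x} → eval a τ ≡ x → eval (load 0 a) τ ≡ s x
    eval-s {x = x} refl = sizes in-τ x

    eval-w : ∀ {a x} → eval a τ ≡ x → eval (load 1 a) τ ≡ w x
    eval-w {x = x} refl = requests in-τ x

  k′≤n : ∀ {k} a b → k ≤ n → k′ k a b ≤ n
  k′≤n {k} a b k≤n = ≤-trans (m∸n≤m k (W a (suc b))) k≤n

  same-inputs : ∀ {b σ τ} → Same σ τ → InputsUpTo b σ → InputsUpTo b τ
  same-inputs {τ = state ρ α} (refl , kept) in-σ = record
    { n≡ = trans (kept 0 refl refl) (n≡ in-σ) ; N≡ = trans (kept 7 refl refl) (N≡ in-σ)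
    ; sizes = sizes in-σ ; requests = requests in-σ
    ; requests-before = requests-before in-σ ; lefts = lefts in-σ }

  Cell : Cells → Cells → ℕ → ℕ → ℕ → State → Set
  Cell D E i j k σ = InputsUpTo n σ × Filled ℜ D (arrays σ 4) × Filled 𝔉 E (arrays σ 5)
                     × regs σ 2 ≡ i × regs σ 3 ≡ j × regs σ 4 ≡ k

  same-cell : ∀ {D E : Cells} {i j k σ τ} → Same σ τ → Cell D E i j k σ → Cell D E i j k τ
  same-cell {τ = state ρ α} same@(refl , kept) (in-σ , fR , fF , r2 , r3 , r4) =
    same-inputs same in-σ , fR , fF , trans (kept 2 refl refl) r2 , trans (kept 3 refl refl) r3 , trans (kept 4 refl refl) r4

  candidate< : ∀ {i j x} → x < j ∸ i → i + x < j
  candidate< {i} {j} {x} x< = proj₂ (∈-range⁻ {i} {j} (∈-applyUpTo⁺ (i +_) x<))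

  -- The ℜ lookup falls into a finished row, the 𝔉 lookup into a finished column of the current row.
  -- Both hold all k up to n, so the reduced k is available as well.
  eval-𝔉-candidate : ∀ {E : Cells} {i j k τ x} → i < n → j < n → k ≤ n → x < j ∸ i → (∀ {x y z} → Before i j k x y z → E x y z) →
                     Cell (Before i j k) E i j k τ → regs τ 6 ≡ x →
                     eval 𝔉-candidate τ ≡ 𝔉-body i j k (i + x)
  eval-𝔉-candidate {_} {i} {j} {k} {τ} {x} i<n j<n k≤n x< E⊇ (in-τ , fR , fF , r2 , r3 , r4) r6 =
    cong₂ _+_ (cong₂ _+_
      (trans (cong (arrays τ 4) (eval-index {lit 1 ⊕ mid} {reg 3 ⊖ lit 1} {reg 4} e-next e-pred r4))
             (fR next<n pred<n k≤n (inj₁ (s≤s (m≤m+n i x)))))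
      (trans (cong (arrays τ 5) (eval-index {reg 2} {mid} {k′-at (reg 4) (lit 1 ⊕ mid) (reg 3 ⊖ lit 1)} r2 e-mid
                (eval-k′ {lit 1 ⊕ mid} {reg 3 ⊖ lit 1} {reg 4} r4 e-next e-pred (<⇒≤ next<n) pred<n)))
             (fF i<n mid<n (k′≤n (suc (i + x)) (pred j) k≤n) (E⊇ (inj₂ (refl , inj₁ mid<j))))))
      (cong₂ _*_ (eval-k′ {reg 2} {reg 3 ⊖ lit 1} {reg 4} r4 r2 e-pred (<⇒≤ i<n) pred<n)
                 (eval-d {mid} {reg 3} e-mid r3 mid<n j<n))
    where
    open At {τ} in-τ
    mid<j : i + x < j
    mid<j = candidate< x<
    mid<n : i + x < n
    mid<n = <-trans mid<j j<n
    next<n : suc (i + x) < n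
    next<n = ≤-<-trans mid<j j<n
    pred<n : pred j < n
    pred<n = ≤-<-trans pred[n]≤n j<n
    e-mid : eval mid τ ≡ i + x
    e-mid = cong₂ _+_ r2 r6
    e-next : eval (lit 1 ⊕ mid) τ ≡ suc (i + x)
    e-next = cong suc e-mid
    e-pred : eval (reg 3 ⊖ lit 1) τ ≡ pred j
    e-pred = cong pred r3

  eval-ℜ-candidate : ∀ {E : Cells} {i j k τ x} → i < n → j < n → k ≤ n → x < j ∸ i →
                     Cell (Before i j k) E i j k τ → regs τ 6 ≡ x →
                     eval ℜ-candidate τ ≡ ℜ-body i j k (suc i + x)
  eval-ℜ-candidate {_} {i} {j} {k} {τ} {x} i<n j<n k≤n x< (in-τ , fR , fF , r2 , r3 , r4) r6 = cong₂ _+_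
    (trans (cong (arrays τ 4) (eval-index {lit 1 ⊕ mid} {reg 3} {reg 4} e-next r3 r4))
           (fR next<n j<n k≤n (inj₁ (s≤s (m≤m+n i x)))))
    (trans (cong (arrays τ 4) (eval-index {reg 2} {mid} {k′-at (reg 4) (lit 1 ⊕ mid) (reg 3)} r2 e-mid
              (eval-k′ {lit 1 ⊕ mid} {reg 3} {reg 4} r4 e-next r3 (<⇒≤ next<n) j<n)))
           (fR i<n mid<n (k′≤n (suc (i + x)) j k≤n) (inj₂ (refl , inj₁ mid<j))))
    where
    open At {τ} in-τ
    mid<j : i + x < j
    mid<j = candidate< x<
    mid<n : i + x < n
    mid<n = <-trans mid<j j<n
    next<n : suc (i + x) < n
    next<n = ≤-<-trans mid<j j<n
    e-mid : eval mid τ ≡ i + x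
    e-mid = cong₂ _+_ r2 r6
    e-next : eval (lit 1 ⊕ mid) τ ≡ suc (i + x)
    e-next = cong suc e-mid

  eval-𝔉 : ∀ {D E : Cells} {i j k τ} → i < n → j < n → Cell D E i j k τ →
           regs τ 5 ≡ minimum (applyUpTo (𝔉-body i j k ∘ (i +_)) (j ∸ i)) → eval compute-𝔉 τ ≡ 𝔉 i j k
  eval-𝔉 {i = i} {j} {k} {τ} i<n j<n (in-τ , _ , _ , r2 , r3 , r4) r5 = trans
    (cong₂ _+_ (cong₂ _+_ (cong₂ _*_ r4 (eval-s {reg 3} r3))
                          (trans r5 (cong minimum (sym (map-applyUpTo (i +_) (𝔉-body i j k) (j ∸ i))))))
               (cong₂ _*_ (eval-k′ {reg 2} {reg 3} {reg 4} r4 r2 r3 (<⇒≤ i<n) j<n) (eval-s {reg 3} r3)))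
    (sym (𝔉-rec i j k))
    where open At {τ} in-τ

  eval-compute-ℜ : ∀ {D E : Cells} {i j k τ} → i < n → j < n → Cell D E i j k τ → regs τ 8 ≡ 𝔉 i j k →
                   eval compute-ℜ τ ≡ 𝔉 i j k + k′ k i j * d j i
  eval-compute-ℜ {i = i} {j} {k} {τ} i<n j<n (in-τ , _ , _ , r2 , r3 , r4) r8 =
    cong₂ _+_ r8 (cong₂ _*_ (eval-k′ {reg 2} {reg 3} {reg 4} r4 r2 r3 (<⇒≤ i<n) j<n) (eval-d {reg 3} {reg 2} r3 r2 j<n i<n))
    where open At {τ} in-τ

  -- The order in which the program works: first the splits, then the 𝔉 alternative. As i < j there
  -- is at least one split, so the default value of `minimum []` does not interfere.
  ℜ-⊓ : ∀ {i j} k → i < j →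
        ℜ i j k ≡ (𝔉 i j k + k′ k i j * d j i) ⊓ minimum (applyUpTo (ℜ-body i j k ∘ (suc i +_)) (j ∸ i))
  ℜ-⊓ {i} {j} k i<j = trans (ℜ-rec k i<j) (trans
    (cong (min (𝔉 i j k + k′ k i j * d j i)) (map-applyUpTo (suc i +_) (ℜ-body i j k) (j ∸ i)))
    (min-applyUpTo _ _ (m<n⇒0<n∸m i<j)))
    where
    min-applyUpTo : ∀ a g {b} → 0 < b → min a (applyUpTo g b) ≡ a ⊓ minimum (applyUpTo g b)
    min-applyUpTo a g {suc b} _ = min-∷ a (g 0) (applyUpTo (g ∘ suc) b)

  Done : Cells → Cells → ℕ → ℕ → ℕ → State → Set
  Done D E i j k τ = Cell D E i j k τ × regs τ 5 ≡ ℜ i j k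

  run-finish-ℜ : ∀ {D E : Cells} {i j k τ} → i < n → j < n → Cell D E i j k τ → regs τ 8 ≡ 𝔉 i j k →
                 regs τ 5 ≡ minimum (applyUpTo (ℜ-body i j k ∘ (suc i +_)) (j ∸ i)) →
                 Run finish-ℜ τ finish-time (Done D E i j k)
  run-finish-ℜ {D} {E} {i} {j} {k} {τ} i<n j<n C@(in-τ , _ , _ , refl , refl , r4) r8 r5 = run-if {e = reg 3} {e′ = reg 2}
    (λ j≤i → run-if {e = reg 2} {e′ = reg 3}
      (λ i≤j → run-≔ (C , diagonal (≤-antisym i≤j j≤i)))
      (λ j<i → run-≔ {e = lit 0} (C , sym (ℜ-empty k j<i))))
    (λ i<j → run-⨟ {Q = λ τ′ → Cell D E i j k τ′ × regs τ′ 8 ≡ c × regs τ′ 5 ≡ b} (run-≔ (C , eval-compute-ℜ {D} {E} {τ = τ} i<n j<n C r8 , r5))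
      (λ { (C′ , r8′ , r5′) → run-if {e = reg 5} {e′ = reg 8}
        (λ b≤c → run-skip (C′ , trans r5′ (trans (sym (m≥n⇒m⊓n≡n (subst₂ _≤_ r5′ r8′ b≤c))) (sym (ℜ-⊓ k i<j)))))
        (λ c<b → run-≔ {e = reg 8} (C′ , trans r8′ (trans (sym (m≤n⇒m⊓n≡m (<⇒≤ (subst₂ _<_ r8′ r5′ c<b)))) (sym (ℜ-⊓ k i<j))))) }))
    where
    open At {τ} in-τ
    b c : ℕ
    b = minimum (applyUpTo (ℜ-body i j k ∘ (suc i +_)) (j ∸ i))
    c = 𝔉 i j k + k′ k i j * d j i
    diagonal : i ≡ j → eval single τ ≡ ℜ i j k
    diagonal i≡j = trans
      (cong₂ _+_ (cong₂ _*_ r4 (eval-s {reg 2} refl)) (cong₂ (λ x y → 2 * x * y) (cong₂ _∸_ r4 (eval-w {reg 2} refl)) (eval-s {reg 2} refl)))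
      (trans (sym (ℜ-base i k)) (cong (λ j → ℜ i j k) i≡j))

  Progress : ℕ → ℕ → ℕ → State → Set
  Progress i j k σ = InputsUpTo n σ × Filled ℜ (Before i j k) (arrays σ 4) × Filled 𝔉 (Before i j k) (arrays σ 5)
                     × regs σ 2 ≡ i × regs σ 3 ≡ j

  run-cell : ∀ {i j k σ} → i < n → j < n → k ≤ n → Progress i j k σ → regs σ 4 ≡ k →
             Run cell σ (cell-time (j ∸ i)) (Progress i j (suc k))
  run-cell {i} {j} {k} {σ} i<n j<n k≤n (in-σ , fR , fF , r2 , r3) r4 =
    run-⨟ (run-minimize (𝔉-body i j k ∘ (i +_)) (cong₂ _∸_ r3 r2)
             (λ {_} {τ} x< same r6 → eval-𝔉-candidate {τ = τ} i<n j<n k≤n x< id (same-cell {τ = τ} same (in-σ , fR , fF , r2 , r3 , r4)) r6))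
    λ {τ₁} (same₁ , r5) → run-⨟
      {Q = λ τ → Cell Old Old i j k τ × regs τ 8 ≡ 𝔉 i j k}
      (let C₁ = same-cell {τ = τ₁} same₁ (in-σ , fR , fF , r2 , r3 , r4) in run-≔ (C₁ , eval-𝔉 {τ = τ₁} i<n j<n C₁ r5))
    λ {τ₂} (C₂ , r8) → run-⨟
      {Q = λ τ → Cell Old New i j k τ × regs τ 8 ≡ 𝔉 i j k}
      (run-store (store-𝔉 {τ₂} C₂ r8 , r8))
    λ {τ₃} (C₃@(_ , _ , _ , r2′ , r3′ , _) , r8) → run-⨟
      (run-minimize (ℜ-body i j k ∘ (suc i +_)) (cong₂ _∸_ r3′ r2′)
        (λ {_} {τ} x< same r6 → eval-ℜ-candidate {New} {τ = τ} i<n j<n k≤n x< (same-cell {E = New} {τ = τ} same C₃) r6))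
    λ {τ₄} (same₄ , r5) → run-⨟
      (run-finish-ℜ i<n j<n (same-cell {Old} {New} {τ = τ₄} same₄ C₃) (trans (proj₂ same₄ 8 refl refl) r8) r5)
    λ {τ₅} (C₅ , r5) → run-store (store-ℜ {τ₅} C₅ r5)
    where
    -- Between the two stores the 𝔉 table is one cell ahead of the ℜ table.
    Old New : Cells
    Old = Before i j k
    New = Before i j (suc k)
    store-𝔉 : ∀ {τ} → Cell Old Old i j k τ → regs τ 8 ≡ 𝔉 i j k →
              Cell Old New i j k (setArray 5 (eval (index (reg 2) (reg 3) (reg 4)) τ) (regs τ 8) τ)
    store-𝔉 {τ} (in-τ , fR , fF , r2 , r3 , r4) r8 = in-τ , fR ,
      subst (λ a → Filled 𝔉 New (arrays τ 5 [ a ↦ regs τ 8 ])) (sym (At.eval-index {τ} in-τ {reg 2} {reg 3} {reg 4} r2 r3 r4))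
        (filled-store {𝔉} {a = arrays τ 5} j<n k≤n r8 fF) , r2 , r3 , r4
    store-ℜ : ∀ {τ} → Cell Old New i j k τ → regs τ 5 ≡ ℜ i j k →
              Progress i j (suc k) (setArray 4 (eval (index (reg 2) (reg 3) (reg 4)) τ) (regs τ 5) τ)
    store-ℜ {τ} (in-τ , fR , fF , r2 , r3 , r4) r5 = in-τ ,
      subst (λ a → Filled ℜ New (arrays τ 4 [ a ↦ regs τ 5 ])) (sym (At.eval-index {τ} in-τ {reg 2} {reg 3} {reg 4} r2 r3 r4))
        (filled-store {ℜ} {a = arrays τ 4} j<n k≤n r5 fR) , fF , r2 , r3

  Row : ℕ → ℕ → State → Set
  Row i j σ = InputsUpTo n σ × Filled ℜ (Before i j 0) (arrays σ 4) × Filled 𝔉 (Before i j 0) (arrays σ 5) × regs σ 2 ≡ i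

  run-column : ∀ {i j σ} → i < n → j < n → Progress i j 0 σ → Run (for 4 (reg 7) cell) σ (column-time n) (Row i (suc j))
  run-column {i} {j} i<n j<n P@(in-σ , _) = run-map ≤-refl (λ {τ} → close-column {τ}) (run-for (Progress i j) (N≡ in-σ) P
    λ { k<1+n (in-τ , fR , fF , r2 , r3) → run-map (cell-time-mono (≤-trans (m∸n≤m j i) (<⇒≤ j<n))) id
          (run-cell i<n j<n (s≤s⁻¹ k<1+n) (in-τ , fR , fF , r2 , r3) refl) })
    where
    covered : ∀ {x y z} → x < n → y < n → z ≤ n → Before i (suc j) 0 x y z → Before i j (suc n) x y z
    covered _ _ _ (inj₁ i<x) = inj₁ i<x
    covered _ _ z≤ (inj₂ (x≡ , inj₁ y<1+j)) with m≤n⇒m<n∨m≡n (s≤s⁻¹ y<1+j)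
    ... | inj₁ y<j = inj₂ (x≡ , inj₁ y<j)
    ... | inj₂ y≡j = inj₂ (x≡ , inj₂ (y≡j , s≤s z≤))
    close-column : ∀ {τ} → Progress i j (suc n) τ → Row i (suc j) τ
    close-column {τ} (in-τ , fR , fF , r2 , _) =
      in-τ , filled-mono {ℜ} {arrays τ 4} covered fR , filled-mono {𝔉} {arrays τ 5} covered fF , r2

  run-row : ∀ {i σ} → i < n → Row i 0 σ → Run row σ (row-time n) (Row i n)
  run-row {i} i<n R@(in-σ , _) = run-for (Row i) (n≡ in-σ) R
    λ { j<n (in-τ , fR , fF , r2) → run-column i<n j<n (in-τ , fR , fF , r2 , refl) }

  Rows : ℕ → State → Set
  Rows b σ = InputsUpTo n σ × Filled ℜ From (arrays σ 4) × Filled 𝔉 From (arrays σ 5)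
    where
    -- The last b rows are finished; writing the condition as a sum avoids truncation.
    From : Cells
    From x _ _ = n ≤ x + b

  run-table : ∀ {σ} → Rows 0 σ → Run table σ (table-time n) (Rows n)
  run-table R@(in-σ , _) = run-for Rows (n≡ in-σ) R λ { {x} {τ} x<n R → step {x} {τ} x<n R }
    where
    step : ∀ {b τ} → b < n → Rows b τ → Run (2 ≔ reg 0 ⊖ lit 1 ⊖ reg 1 ⨟ row) (setReg 1 b τ) (6 + row-time n) (Rows (suc b))
    step {b} {τ} b<n (in-τ , fR , fF) = run-⨟ {Q = Row i 0} (run-≔
        (in-τ , filled-mono {ℜ} {arrays τ 4} below fR , filled-mono {𝔉} {arrays τ 5} below fF , cong (λ x → x ∸ 1 ∸ b) (n≡ in-τ)))
      λ {τ′} R′ → run-map ≤-refl (λ { {υ} (in-υ , fR′ , fF′ , _) →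
        in-υ , filled-mono {ℜ} {arrays υ 4} upto fR′ , filled-mono {𝔉} {arrays υ 5} upto fF′ }) (run-row {i} {τ′} (s≤s (m∸n≤m last b)) R′)
      where
      i : ℕ
      i = last ∸ b
      i+b : i + b ≡ last
      i+b = m∸n+n≡m (s≤s⁻¹ b<n)
      below : ∀ {x y z} → x < n → y < n → z ≤ n → Before i 0 0 x y z → n ≤ x + b
      below {x} _ _ _ (inj₁ i<x) = subst (_≤ x + b) (cong suc i+b) (+-monoˡ-≤ b i<x)
      below _ _ _ (inj₂ (_ , inj₁ ()))
      below _ _ _ (inj₂ (_ , inj₂ (_ , ())))
      upto : ∀ {x y z} → x < n → y < n → z ≤ n → n ≤ x + suc b → Before i n 0 x y z
      upto {x} _ y<n _ n≤ with m≤n⇒m<n∨m≡n (+-cancelʳ-≤ (suc b) i x (≤-trans (≤-reflexive (trans (+-suc i b) (cong suc i+b))) n≤))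
      ... | inj₁ i<x = inj₁ i<x
      ... | inj₂ i≡x = inj₂ (sym i≡x , inj₁ y<n)

  run-setup : Run setup (input I) (setup-time n) (Rows 0)
  run-setup = run-⨟ {Q = Ready 0} (run-≔ ready₀)
    λ { R@(in-τ , _) → run-map ≤-refl (λ { (in-υ , _) → in-υ , nothing , nothing })
      (run-for Ready (n≡ in-τ) R λ { {b} {τ} _ R → step {b} {τ} R }) }
    where
    nothing : ∀ {A : Set} {x y z} → x < n → y < n → z ≤ n → n ≤ x + 0 → A
    nothing {x = x} x<n _ _ n≤ = contradiction (subst (n ≤_) (+-identityʳ x) n≤) (<⇒≱ x<n)
    Ready : ℕ → State → Set
    Ready b σ = InputsUpTo b σ × regs σ 0 ≡ n
    ready₀ : Ready 0 (setReg 7 (suc n) (input I))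
    ready₀ = record { n≡ = refl ; N≡ = refl ; sizes = λ _ → refl ; requests = λ _ → refl
                    ; requests-before = λ { z≤n → refl } ; lefts = λ { z≤n → refl } } , refl
    step : ∀ {b τ} → Ready b τ → Run add-file (setReg 1 b τ) 18 (Ready (suc b))
    step {b} {τ} (in-τ , r0) = run (record
      { n≡ = n≡ in-τ ; N≡ = N≡ in-τ ; sizes = sizes in-τ ; requests = requests in-τ
      ; requests-before = prefix-store (requests-before in-τ) (cong (arrays τ 2 b +_) (requests in-τ b))
      ; lefts = prefix-store (lefts in-τ) (cong (arrays τ 3 b +_) (sizes in-τ b)) } , r0) ≤-refl

  m≤n : m ≤ n
  m≤n = ∑≤ req req≤1
    where
    ∑≤ : ∀ {N} (f : Fin N → ℕ) → (∀ i → f i ≤ 1) → ∑[ i < N ] f i ≤ N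
    ∑≤ {zero}  f f≤1 = z≤n
    ∑≤ {suc N} f f≤1 = +-mono-≤ (f≤1 zero) (∑≤ (f ∘ suc) (f≤1 ∘ suc))

  run-solve : Run solve (input I) (solve-time n) (λ σ → regs σ 0 ≡ ℜ 0 last m)
  run-solve = run-⨟ run-setup λ R₀ → run-⨟ (run-table R₀) λ {σ} R → run-≔ (result {σ} R)
    where
    result : ∀ {σ} → Rows n σ → eval (ℜ-at (lit 0) (reg 0 ⊖ lit 1) (load 2 (reg 0))) σ ≡ ℜ 0 last m
    result {σ} (in-σ , fR , _) = trans
      (cong (arrays σ 4) (At.eval-index {σ} in-σ {lit 0} {reg 0 ⊖ lit 1} {load 2 (reg 0)} refl (cong pred (n≡ in-σ))
        (trans (cong (arrays σ 2) (n≡ in-σ)) (trans (requests-before in-σ ≤-refl) W-all))))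
      -- The cell read at the end lies in the table because m ≤ n.
      (fR (s≤s z≤n) ≤-refl m≤n ≤-refl)

-- The polynomial bound.

loop-time-≤ : ∀ p {N t} c → 0 < N → t ≤ c * N ^ p → 2 + N * suc t ≤ (3 + c) * N ^ suc p
loop-time-≤ p {N@(suc _)} {t} c _ t≤ = begin
  2 + N * suc t
    -- The 3 collects the 2 units of the loop itself and 1 unit per iteration.
    ≤⟨ +-mono-≤ (m≤m*n 2 (N ^ suc p) {{m^n≢0 N (suc p)}}) (*-monoʳ-≤ N (+-mono-≤ (m^n>0 N p) t≤)) ⟩
  2 * (N * N ^ p) + N * (N ^ p + c * N ^ p) ≡⟨ lemma N (N ^ p) c ⟩
  (3 + c) * (N * N ^ p)                  ∎
  where
  open ≤-Reasoning
  lemma : ∀ a b c → 2 * (a * b) + a * (b + c * b) ≡ (3 + c) * (a * b)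
  lemma = solve-∀

-- The factor `1 * u` is kept so that the coefficient is `minimize-time e 1` by computation, and the
-- sum in `cell-time-≤` becomes `cell-time 1`.
affine-≤ : ∀ {N} a u → 0 < N → a + N * u ≤ (a + 1 * u) * N
affine-≤ {N@(suc _)} a u _ = ≤-trans (+-monoˡ-≤ (N * u) (m≤m*n a N)) (≤-reflexive (lemma a u N))
  where
  lemma : ∀ a u N → a * N + N * u ≡ (a + 1 * u) * N
  lemma = solve-∀

cell-time-≤ : ∀ {N} → 0 < N → cell-time N ≤ cell-time 1 * N
cell-time-≤ {N@(suc _)} 0<N = begin
  minimize-time 𝔉-candidate N + (a + (b + (minimize-time ℜ-candidate N + e)))
    ≤⟨ +-mono-≤ (affine-≤ 6 u 0<N) (+-mono-≤ (m≤m*n a N) (+-mono-≤ (m≤m*n b N) (+-mono-≤ (affine-≤ 6 v 0<N) (m≤m*n e N)))) ⟩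
  (6 + 1 * u) * N + (a * N + (b * N + ((6 + 1 * v) * N + e * N)))
    ≡⟨ lemma (6 + 1 * u) a b (6 + 1 * v) e N ⟩
  cell-time 1 * N ∎
  where
  open ≤-Reasoning
  a b e u v : ℕ
  a = suc (time compute-𝔉)
  b = suc (index-time + 1)
  e = finish-time + suc (index-time + 1)
  u = suc (improve-time 𝔉-candidate)
  v = suc (improve-time ℜ-candidate)
  lemma : ∀ x a b y e N → x * N + (a * N + (b * N + (y * N + e * N))) ≡ (x + (a + (b + (y + e)))) * N
  lemma = solve-∀

m≤m*N^p : ∀ a {N} p → 0 < N → a ≤ a * N ^ p
m≤m*N^p a {N@(suc _)} p _ = m≤m*n a (N ^ p) {{m^n≢0 N p}}

-- The loops over k, j and i each raise the degree of the linear cell cost by one. Inside out, the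
-- constant has 3 + a for k, doubled for its extra round, 3 for j, 6 for assigning i and 3 for the
-- loop over i; 25 = 6 + 19 covers the set-up and f the final lookup.
nested-loops-≤ : ∀ N t a f → 0 < N → t ≤ a * N →
  (4 + (2 + N * 19)) + ((2 + N * suc (6 + (2 + N * suc (2 + suc N * suc t)))) + f)
    ≤ (25 + ((3 + (6 + (3 + 2 * (3 + a)))) + f)) * N ^ 4
nested-loops-≤ N t a f 0<N t≤ = begin
  (4 + (2 + N * 19)) + ((2 + N * suc (6 + row-t)) + f)
    ≤⟨ +-mono-≤ setup≤ (+-mono-≤ (loop-time-≤ 3 c₃ 0<N row-t≤) (m≤m*N^p f 4 0<N)) ⟩
  25 * N ^ 4 + (c₄ * N ^ 4 + f * N ^ 4)               ≡⟨ lemma 25 c₄ f (N ^ 4) ⟩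
  (25 + (c₄ + f)) * N ^ 4                             ∎
  where
  open ≤-Reasoning
  column-t row-t c₂ c₃ c₄ : ℕ
  column-t = 2 + suc N * suc t
  row-t    = 2 + N * suc column-t
  c₂ = 2 * (3 + a)
  c₃ = 6 + (3 + c₂)
  c₄ = 3 + c₃
  lemma : ∀ a b c x → a * x + (b * x + c * x) ≡ (a + (b + c)) * x
  lemma = solve-∀
  setup≤ : 4 + (2 + N * 19) ≤ 25 * N ^ 4
  setup≤ = begin
    6 + N * 19  ≤⟨ affine-≤ 6 19 0<N ⟩
    25 * N      ≤⟨ *-monoʳ-≤ 25 (m≤m*N^p N 3 0<N) ⟩
    25 * N ^ 4  ∎
  -- The loop over k runs N + 1 times, and one extra round costs no more than the other N together.
  double : ∀ t → 2 + suc N * t ≤ 2 * (2 + N * t)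
  double t = begin
    2 + (t + N * t)
      ≤⟨ +-monoʳ-≤ 2 (+-monoˡ-≤ (N * t) (≤-trans (m≤m*N^p t 1 0<N) (≤-reflexive (trans (cong (t *_) (*-identityʳ N)) (*-comm t N))))) ⟩
    2 + (N * t + N * t)        ≤⟨ m≤n+m (2 + (N * t + N * t)) 2 ⟩
    2 + (2 + (N * t + N * t))  ≡⟨ lemma₂ (N * t) ⟩
    2 * (2 + N * t)            ∎
    where
    lemma₂ : ∀ x → 2 + (2 + (x + x)) ≡ 2 * (2 + x)
    lemma₂ = solve-∀
  column-t≤ : column-t ≤ c₂ * N ^ 2
  column-t≤ = begin
    2 + suc N * suc t        ≤⟨ double (suc t) ⟩
    2 * (2 + N * suc t)
      ≤⟨ *-monoʳ-≤ 2 (loop-time-≤ 1 a 0<N (≤-trans t≤ (≤-reflexive (cong (a *_) (sym (*-identityʳ N)))))) ⟩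
    2 * ((3 + a) * N ^ 2)    ≡⟨ sym (*-assoc 2 (3 + a) (N ^ 2)) ⟩
    c₂ * N ^ 2               ∎
  row-t≤ : 6 + row-t ≤ c₃ * N ^ 3
  row-t≤ = begin
    6 + row-t                       ≤⟨ +-mono-≤ (m≤m*N^p 6 3 0<N) (loop-time-≤ 2 c₂ 0<N column-t≤) ⟩
    6 * N ^ 3 + (3 + c₂) * N ^ 3  ≡⟨ sym (*-distribʳ-+ (N ^ 3) 6 (3 + c₂)) ⟩
    c₃ * N ^ 3                    ∎

result-time : ℕ
result-time = suc (time (ℜ-at (lit 0) (reg 0 ⊖ lit 1) (load 2 (reg 0))))

solve-time-≤ : ∃ λ c → ∀ N → 0 < N → solve-time N ≤ c * N ^ 4
solve-time-≤ = 25 + ((3 + (6 + (3 + 2 * (3 + cell-time 1)))) + result-time) , λ N 0<N →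
  nested-loops-≤ N (cell-time N) (cell-time 1) result-time 0<N (cell-time-≤ 0<N)

open LTS using (IsOptimalValue; ℜ; n; m; last)

theorem1 : (∀ (I : LTS) → IsOptimalValue I (ℜ I 0 (last I) (m I)))
    × (∃ λ (P : Program) → ∃ λ (c : ℕ) → ∀ (I : LTS) →
    (output P I ≡ ℜ I 0 (last I) (m I))
    × (runningTime P I ≤ c * n I ^ 4))
theorem1 = UpperBound.ℜ-optimal , solve , proj₁ solve-time-≤ , λ I →
  let solved = Correctness.run-solve I in
  Run.post solved , ≤-trans (Run.elapsed solved) (proj₂ solve-time-≤ (n I) (s≤s z≤n))
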